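{- Let $H$ be a complete multipartite graph and let $\varepsilon>0$. There is a constant $C$ (depending only on $H$ and $\varepsilon$) such that for all positive integers $n,N$ with $N\ge C n^{\delta(H)}$, every $N$-vertex graph with no independent set of size $n$ contains at least $$\frac{1-\varepsilon}{|\mathrm{Aut}(H)|}\,N^{|V(H)|}\,n^{ -|E(H)|}$$ unlabeled copies of $H$; that is, $f(N,H,n)\ge \frac{1-\varepsilon}{|\mathrm{Aut}(H)|}N^{|V(H)|}n^{ -|E(H)|}$.
   Context: Graphs are finite and simple. $\delta(H)$ is the minimum degree of $H$ and $\mathrm{Aut}(H)$ its automorphism group. An unlabeled copy of $H$ in $G$ is a (not necessarily induced) subgraph of $G$ isomorphic to $H$. $f(N,H,n)$ denotes the minimum number of unlabeled copies of $H$ in an $N$-vertex graph with no independent set of size $n$. -}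

module Defs where

open import Level using (0ℓ)
open import Data.Bool.Base using (Bool; true; false)
open import Data.Fin.Base as Fin using (Fin)
open import Data.Fin.Properties as Fin using (all?; any?)
open import Data.Fin.Subset using (Subset; _∈_; ∣_∣)
open import Data.Fin.Subset.Properties using (_∈?_)
open import Data.Integer.Base using (+_)
open import Data.List.Base as List using (List; []; _∷_; allFin; cartesianProduct; cartesianProductWith; filter; length)
open import Data.List.Membership.Propositional as List using (find; lose)
open import Data.List.Membership.Propositional.Properties
  using (∈-allFin; ∈-cartesianProduct⁺; ∈-cartesianProductWith⁺; ∈-filter⁺)
open import Data.List.Relation.Unary.All as All using ([]; _∷_)
open import Data.List.Relation.Unary.AllPairs using ([]; _∷_)
open import Data.List.Relation.Unary.Any as Any using (here; there)
open import Data.List.Relation.Unary.Unique.Propositional using (Unique)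
import Data.List.Relation.Unary.Unique.Propositional.Properties as Unique
open import Data.Nat.Base using (ℕ; suc; _*_; _^_; _⊓_; _≤_; NonZero)
open import Data.Nat.Properties using (m*n≢0; m^n≢0)
open import Data.Product using (∃; ∃-syntax; Σ-syntax; _×_; _,_; proj₁; proj₂)
open import Data.Rational.Base as ℚ using (ℚ; 1ℚ)
open import Data.Vec.Base as Vec using (Vec; []; _∷_; lookup)
open import Data.Vec.Properties using (∷-injective; lookup-allFin)
open import Function using (Injective; Surjective; Bijective; _⇔_; mk⇔; Equivalence; _∘_)
open import Function.Construct.Identity using (⇔-id)
open import Relation.Binary using (Rel; Decidable; Symmetric; Irreflexive)
open import Relation.Binary.PropositionalEquality
open import Relation.Nullary using (Dec; ¬_; map′; _×-dec_; _→-dec_)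
import Relation.Unary as U

record Enumeration (A : Set) : Set where
  field
    elems    : List A
    complete : ∀ x → x List.∈ elems
    unique   : Unique elems

open Enumeration

count : {A : Set} {P : U.Pred A 0ℓ} → Enumeration A → U.Decidable P → ℕ
count en P? = length (filter P? (elems en))

bools : Enumeration Bool
bools .elems          = true ∷ false ∷ []
bools .complete true  = here refl
bools .complete false = there (here refl)
bools .unique         = ((λ ()) ∷ []) ∷ [] ∷ []

fins : ∀ n → Enumeration (Fin n)
fins n .elems    = allFin n
fins n .complete = ∈-allFin
fins n .unique   = Unique.allFin⁺ n

pairs : {A B : Set} → Enumeration A → Enumeration B → Enumeration (A × B)
pairs as bs .elems            = cartesianProduct (elems as) (elems bs)
pairs as bs .complete (x , y) = ∈-cartesianProduct⁺ (complete as x) (complete bs y)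
pairs as bs .unique           = Unique.cartesianProduct⁺ (unique as) (unique bs)

vecs : {A : Set} → Enumeration A → ∀ n → Enumeration (Vec A n)
vecs as ℕ.zero  .elems             = [] ∷ []
vecs as (suc n) .elems             = cartesianProductWith _∷_ (elems as) (elems (vecs as n))
vecs as ℕ.zero  .complete []       = here refl
vecs as (suc n) .complete (x ∷ xs) =
  ∈-cartesianProductWith⁺ _∷_ (complete as x) (complete (vecs as n) xs)
vecs as ℕ.zero  .unique            = [] ∷ []
vecs as (suc n) .unique            =
  Unique.cartesianProductWith⁺ _∷_ ∷-injective (unique as) (unique (vecs as n))

∃? : {A : Set} {P : U.Pred A 0ℓ} → Enumeration A → U.Decidable P → Dec (∃ P)
∃? en P? = map′ (λ p → let x , _ , px = find p in x , px)
                (λ (x , px) → lose (complete en x) px)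
                (Any.any? P? (elems en))

record Graph (n : ℕ) : Set₁ where
  field
    Adj        : Rel (Fin n) 0ℓ
    Adj?       : Decidable Adj
    adj-sym    : Symmetric Adj
    adj-irrefl : Irreflexive _≡_ Adj

open Graph using (Adj; Adj?)

degree : ∀ {n} → Graph n → Fin n → ℕ
degree {n} G v = count (fins n) (Adj? G v)

-- The minimum degree needs at least one vertex.
δ : ∀ {k} → Graph (suc k) → ℕ
δ G = Vec.foldr₁ _⊓_ (Vec.tabulate (degree G))

edgeCount : ∀ {n} → Graph n → ℕ
edgeCount {n} G =
  count (pairs (fins n) (fins n)) (λ (i , j) → (i Fin.<? j) ×-dec Adj? G i j)

CompleteMultipartite : ∀ {n} → Graph n → Set
CompleteMultipartite {n} G =
  ∃[ r ] Σ[ part ∈ (Fin n → Fin r) ]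
    Surjective _≡_ _≡_ part × (∀ i j → Adj G i j ⇔ part i ≢ part j)

Independent : ∀ {n} → Graph n → Subset n → Set
Independent G S = ∀ {i j} → i ∈ S → j ∈ S → ¬ Adj G i j

NoIndependentSetOfSize : ∀ {N} → ℕ → Graph N → Set
NoIndependentSetOfSize n G = ∀ S → ∣ S ∣ ≡ n → ¬ Independent G S

infix 2 _⇔?_
_⇔?_ : {A B : Set} → Dec A → Dec B → Dec (A ⇔ B)
a? ⇔? b? = map′ (λ (f , g) → mk⇔ f g)
                (λ e → Equivalence.to e , Equivalence.from e)
                ((a? →-dec b?) ×-dec (b? →-dec a?))

injective? : ∀ {m n} (f : Fin m → Fin n) → Dec (Injective _≡_ _≡_ f)
injective? f = map′ (λ h {x} {y} → h x y) (λ h x y → h)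
  (all? λ x → all? λ y → (f x Fin.≟ f y) →-dec (x Fin.≟ y))

surjective? : ∀ {m n} (f : Fin m → Fin n) → Dec (Surjective _≡_ _≡_ f)
surjective? f = map′ (λ h y → proj₁ (h y) , λ { refl → proj₂ (h y) })
                     (λ h y → proj₁ (h y) , proj₂ (h y) refl)
  (all? λ y → any? λ x → f x Fin.≟ y)

-- Maps between vertex sets are vectors of values, so that distinct
-- vectors are distinct maps.
IsAutomorphism : ∀ {k} → Graph k → Vec (Fin k) k → Set
IsAutomorphism H σ =
  Bijective _≡_ _≡_ (lookup σ) ×
  (∀ a b → Adj H a b ⇔ Adj H (lookup σ a) (lookup σ b))

isAutomorphism? : ∀ {k} (H : Graph k) → U.Decidable (IsAutomorphism H)
isAutomorphism? H σ =
  (injective? (lookup σ) ×-dec surjective? (lookup σ)) ×-dec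
  (all? λ a → all? λ b → Adj? H a b ⇔? Adj? H (lookup σ a) (lookup σ b))

∣Aut_∣ : ∀ {k} → Graph k → ℕ
∣Aut_∣ {k} H = count (vecs (fins k) k) (isAutomorphism? H)

-- A vertex set together with a Boolean matrix of edges: j is a neighbour
-- of i when j ∈ lookup E i.
Sub : ℕ → Set
Sub N = Subset N × Vec (Subset N) N

subs : ∀ N → Enumeration (Sub N)
subs N = pairs (vecs bools N) (vecs (vecs bools N) N)

IsSubgraph : ∀ {N} → Graph N → Sub N → Set
IsSubgraph G (V , E) =
  (∀ i j → j ∈ lookup E i → i ∈ lookup E j) ×
  (∀ i j → j ∈ lookup E i → i ∈ V × j ∈ V × Adj G i j)

IsIsomorphism : ∀ {k N} → Graph k → Sub N → Vec (Fin N) k → Set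
IsIsomorphism H (V , E) φ =
  Injective _≡_ _≡_ (lookup φ) ×
  (∀ v → v ∈ V ⇔ (∃[ a ] lookup φ a ≡ v)) ×
  (∀ a b → Adj H a b ⇔ lookup φ b ∈ lookup E (lookup φ a))

IsCopy : ∀ {k N} → Graph k → Graph N → Sub N → Set
IsCopy H G S = IsSubgraph G S × ∃ (IsIsomorphism H S)

isSubgraph? : ∀ {N} (G : Graph N) → U.Decidable (IsSubgraph G)
isSubgraph? G (V , E) =
  (all? λ i → all? λ j → (j ∈? lookup E i) →-dec (i ∈? lookup E j)) ×-dec
  (all? λ i → all? λ j →
    (j ∈? lookup E i) →-dec ((i ∈? V) ×-dec (j ∈? V) ×-dec Adj? G i j))

isIsomorphism? : ∀ {k N} (H : Graph k) (S : Sub N) → U.Decidable (IsIsomorphism H S)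
isIsomorphism? H (V , E) φ =
  injective? (lookup φ) ×-dec
  (all? λ v → (v ∈? V) ⇔? any? (λ a → lookup φ a Fin.≟ v)) ×-dec
  (all? λ a → all? λ b → Adj? H a b ⇔? (lookup φ b ∈? lookup E (lookup φ a)))

isCopy? : ∀ {k N} (H : Graph k) (G : Graph N) → U.Decidable (IsCopy H G)
isCopy? {k} {N} H G S =
  isSubgraph? G S ×-dec ∃? (vecs (fins N) k) (isIsomorphism? H S)

copies : ∀ {k N} → Graph k → Graph N → ℕ
copies {N = N} H G = count (subs N) (isCopy? H G)

-- f(N,H,n) = m, as a relation: when no N-vertex graph without an
-- independent set of size n exists (e.g. n = 1 ≤ N), there is no minimum.
f[_,_,_]≡_ : ∀ {k} (N : ℕ) → Graph k → (n : ℕ) → ℕ → Set₁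
f[ N , H , n ]≡ m =
  (∃[ G ] NoIndependentSetOfSize {N} n G × copies H G ≡ m) ×
  (∀ (G : Graph N) → NoIndependentSetOfSize n G → m ≤ copies H G)

∣Aut∣≢0 : ∀ {k} (H : Graph k) → NonZero ∣Aut H ∣
∣Aut∣≢0 {k} H = nonEmpty (∈-filter⁺ (isAutomorphism? H)
  (complete (vecs (fins k) k) (Vec.allFin k)) (bijective , preserves))
  where
  nonEmpty : {A : Set} {x : A} {xs : List A} → x List.∈ xs → NonZero (length xs)
  nonEmpty (here _)  = _
  nonEmpty (there _) = _

  bijective : Bijective _≡_ _≡_ (lookup (Vec.allFin k))
  bijective =
    (λ {x} {y} e → trans (sym (lookup-allFin x)) (trans e (lookup-allFin y))) ,
    (λ y → y , λ { refl → lookup-allFin y })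

  preserves : ∀ a b → Adj H a b ⇔ Adj H (lookup (Vec.allFin k) a) (lookup (Vec.allFin k) b)
  preserves a b rewrite lookup-allFin a | lookup-allFin b = ⇔-id _

-- (1 − ε) / |Aut H| · N^|V(H)| · n^(−|E(H)|)
lowerBound : ∀ {k} → Graph k → ℚ → (N n : ℕ) .{{_ : NonZero n}} → ℚ
lowerBound {k} H ε N n =
  (1ℚ ℚ.- ε) ℚ.* (+ (N ^ k) ℚ./ (∣Aut H ∣ * n ^ edgeCount H))
  where
  instance
    nz : NonZero (∣Aut H ∣ * n ^ edgeCount H)
    nz = m*n≢0 ∣Aut H ∣ (n ^ edgeCount H) {{∣Aut∣≢0 H}} {{m^n≢0 n (edgeCount H)}}

-- Remove one part of H, of size s, and sum over the injective s-tuples T of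
-- vertices of G.  By Turán the average degree is about N / n, so by the power
-- mean inequality the common neighbourhood W_T has average size about
-- N / n ^ s.  It contains no independent set of size n either, so by induction
-- it contains about |W_T| ^ v · n ^ (- e′) copies of what remains of H, and the
-- power mean inequality for |W_T| ^ v gives the bound.  The last part standing
-- costs nothing, so the threshold exponent is the number of vertices outside
-- it; taking it to be the part of a vertex of minimum degree makes this δ(H).
-- Throughout, 1 − ε is represented as M / (M + 1), and an estimate
-- a ≥ (1 − ε) b as M b ≤ (M + 1) a.
module Submission where

open import Defs
open import Data.Bool.Base using (true; false)
open import Data.Empty using (⊥-elim)
open import Data.Fin.Base using (Fin; zero; suc) renaming (_<_ to _<ᶠ_)
open import Data.Fin.Properties as Finₚ using (_≟_; all?; any?; ¬∀⟶∃¬)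
open import Data.Fin.Subset using (Subset; inside; outside; ⊥; ∣_∣) renaming (_∈_ to _∈ₛ_)
open import Data.Fin.Subset.Properties using (∣⊥∣≡0; ∉⊥)
open import Data.List.Base as List using (List; []; _∷_; _++_; length; map; filter; concatMap; allFin)
open import Data.List.Extrema.Nat using (argmin; f[argmin]≤f[⊤]; f[argmin]≤f[xs]; argmin-sel)
open import Data.List.Membership.Propositional using (_∈_)
open import Data.List.Membership.Propositional.Properties using (∈-∃++; ∈-length; ∈-concat⁻′; ∈-map⁺; ∈-map⁻; ∈-++⁻; ∈-filter⁺; ∈-filter⁻)
open import Data.List.Properties using (length-++; length-++-sucʳ; length-map; length-filter; length-tabulate; filter-++; filter-all)
open import Data.List.Relation.Binary.Sublist.Propositional using (⊆-refl)
open import Data.List.Relation.Binary.Sublist.Propositional.Properties using (length-mono-≤; filter⁺; filter-⊆)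
open import Data.List.Relation.Unary.All as All using (All; []; _∷_)
import Data.List.Relation.Unary.All.Properties as All
open import Data.List.Relation.Unary.AllPairs as AllPairs using (AllPairs; []; _∷_)
import Data.List.Relation.Unary.AllPairs.Properties as AllPairs
open import Data.List.Relation.Unary.Any using (here; there)
open import Data.List.Relation.Unary.Unique.Propositional using (Unique)
import Data.List.Relation.Unary.Unique.Propositional.Properties as Unique
open import Data.Nat.Base as ℕ using (ℕ; zero; suc; _+_; _*_; _^_; _≥_; NonZero)
open import Data.Nat.Induction using (<-rec)
open import Data.Nat.ListAction using (sum)
import Data.Nat.Properties as ℕₚ
open import Data.Nat.Tactic.RingSolver using (solve-∀)
open import Data.Product using (∃-syntax; Σ-syntax; _×_; _,_; proj₁; proj₂)
open import Data.Product.Properties using (,-injectiveʳ)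
open import Data.Sum.Base as Sum using (_⊎_; inj₁; inj₂; [_,_]′)
open import Data.Sum.Properties using (inj₁-injective; inj₂-injective)
open import Data.Unit.Base using (⊤; tt)
open import Data.Vec.Base as Vec using (Vec; []; _∷_; lookup; tabulate; _[_]≔_)
open import Data.Vec.Properties using (∷-injective; lookup∘tabulate; tabulate∘lookup; tabulate-cong; lookup∘updateAt′; []=⇒lookup; lookup⇒[]=)
import Data.Vec.Relation.Unary.All as Vecᴬ
import Data.Vec.Relation.Unary.All.Properties as Vecᴬ
open import Function using (_∘_; Injective; const; mk⇔; Equivalence)
open import Relation.Binary.PropositionalEquality
open import Relation.Nullary using (Dec; yes; no; ¬_; ¬?; does; contradiction; _×-dec_; _⊎-dec_)
open import Relation.Nullary.Decidable using (dec-true)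
open import Relation.Unary using (Decidable)

-- The obstacle is that the induction hypothesis speaks only of common neighbourhoods above its own
-- threshold C₂ n^d′, while averaging over T says nothing about a single T. A small W_T is therefore
-- given no embeddings at all, and its share |W_T|^v is charged to an error of at most (C₂ n^d′)^v.
-- There are at most w^s tuples, and after multiplication by n^(s v) the total error is a small
-- fraction of w^(s+v) as soon as w is a large multiple of n^(s+d′). This is how each removed part
-- comes to raise the threshold exponent by its size. The induction keeps G fixed and varies a
-- duplicate-free list W of its vertices, so that one hypothesis on G serves every common
-- neighbourhood. Requiring the entries of T to be distinct costs a bounded amount per degree, which
-- is of lower order. A step has three losses: the terms dropped in the averaging, the precision of
-- the induction hypothesis, and the error above. Precision 2M + 1 in each of them leaves precision
-- M. All estimates are cross-multiplied and stay in the natural numbers.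

module Counting where

  open import Data.Nat.Base
  open import Data.Nat.Properties hiding (_≟_)

  open Enumeration using (elems; complete)
  open Equivalence using (to; from)
  open ≤-Reasoning

  -- Sums over lists and elementary inequalities

  ∑ : {A : Set} → List A → (A → ℕ) → ℕ
  ∑ xs f = sum (map f xs)

  syntax ∑ xs (λ x → e) = ∑[ x ∈ xs ] e

  module _ {A : Set} where

    ∑-mono : ∀ (xs : List A) {f g : A → ℕ} → (∀ {x} → x ∈ xs → f x ≤ g x) → ∑ xs f ≤ ∑ xs g
    ∑-mono []       f≤g = z≤n
    ∑-mono (x ∷ xs) f≤g = +-mono-≤ (f≤g (here refl)) (∑-mono xs (f≤g ∘ there))

    ∑-cong : ∀ (xs : List A) {f g : A → ℕ} → (∀ x → f x ≡ g x) → ∑ xs f ≡ ∑ xs g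
    ∑-cong []       f≡g = refl
    ∑-cong (x ∷ xs) f≡g = cong₂ _+_ (f≡g x) (∑-cong xs f≡g)

    ∑-+ : ∀ (xs : List A) (f g : A → ℕ) → ∑[ x ∈ xs ] (f x + g x) ≡ ∑ xs f + ∑ xs g
    ∑-+ []       f g = refl
    ∑-+ (x ∷ xs) f g rewrite ∑-+ xs f g = shuffle (f x) (g x) (∑ xs f) (∑ xs g)
      where
      shuffle : ∀ a b c d → (a + b) + (c + d) ≡ (a + c) + (b + d)
      shuffle = solve-∀

    ∑-*ˡ : ∀ (xs : List A) c (f : A → ℕ) → ∑[ x ∈ xs ] (c * f x) ≡ c * ∑ xs f
    ∑-*ˡ []       c f = sym (*-zeroʳ c)
    ∑-*ˡ (x ∷ xs) c f = trans (cong (c * f x +_) (∑-*ˡ xs c f)) (sym (*-distribˡ-+ c (f x) (∑ xs f)))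

    ∑-const : ∀ (xs : List A) c → ∑[ x ∈ xs ] c ≡ length xs * c
    ∑-const []       c = refl
    ∑-const (x ∷ xs) c = cong (c +_) (∑-const xs c)

    ∑-filter-split : ∀ {P : A → Set} (P? : Decidable P) (xs : List A) (f : A → ℕ) →
      ∑ xs f ≡ ∑ (filter P? xs) f + ∑ (filter (¬? ∘ P?) xs) f
    ∑-filter-split P? []       f = refl
    ∑-filter-split P? (x ∷ xs) f with does (P? x)
    ... | true  = trans (cong (f x +_) (∑-filter-split P? xs f)) (sym (+-assoc (f x) _ _))
    ... | false = trans (cong (f x +_) (∑-filter-split P? xs f))
                        (shuffle (f x) (∑ (filter P? xs) f) (∑ (filter (¬? ∘ P?) xs) f))
      where
      shuffle : ∀ a b c → a + (b + c) ≡ b + (a + c)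
      shuffle = solve-∀

  ∑-length-filter-swap : ∀ {A B : Set} {R : A → B → Set} (R? : ∀ x y → Dec (R x y)) xs ys →
    ∑[ x ∈ xs ] length (filter (R? x) ys) ≡ ∑[ y ∈ ys ] length (filter (λ x → R? x y) xs)
  ∑-length-filter-swap {A} {B} R? []       ys = sym (trans (∑-const ys 0) (*-zeroʳ (length ys)))
  ∑-length-filter-swap {A} {B} R? (x ∷ xs) ys = begin-equality
    length (filter (R? x) ys) + ∑[ x ∈ xs ] length (filter (R? x) ys)
      ≡⟨ cong (length (filter (R? x) ys) +_) (∑-length-filter-swap R? xs ys) ⟩
    length (filter (R? x) ys) + ∑[ y ∈ ys ] length (filter (λ x → R? x y) xs)
      ≡⟨ column ys ⟩
    ∑[ y ∈ ys ] length (filter (λ x → R? x y) (x ∷ xs))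
      ∎
    where
    shuffle : ∀ a b c → a + (b + c) ≡ b + (a + c)
    shuffle = solve-∀

    degᴮ : B → ℕ
    degᴮ y = length (filter (λ x → R? x y) xs)

    step   : ∀ y ys → length (filter (R? x) ys) + (degᴮ y + ∑ ys degᴮ)
                    ≡ degᴮ y + ∑[ y ∈ ys ] length (filter (λ x → R? x y) (x ∷ xs))
    column : ∀ ys → length (filter (R? x) ys) + ∑ ys degᴮ
                  ≡ ∑[ y ∈ ys ] length (filter (λ x → R? x y) (x ∷ xs))
    step y ys = trans (shuffle _ (degᴮ y) (∑ ys degᴮ)) (cong (degᴮ y +_) (column ys))
    column []       = refl
    column (y ∷ ys) with does (R? x y)
    ... | true  = cong suc (step y ys)
    ... | false = step y ys

  ^-distribʳ-* : ∀ k m n → (m * n) ^ k ≡ m ^ k * n ^ k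
  ^-distribʳ-* zero    m n = refl
  ^-distribʳ-* (suc k) m n = trans (cong (m * n *_) (^-distribʳ-* k m n)) (shuffle m n (m ^ k) (n ^ k))
    where
    shuffle : ∀ a b c d → a * b * (c * d) ≡ a * c * (b * d)
    shuffle = solve-∀

  -- With b = a + x and d = c + y the two sides differ by x y.
  rearrangement : ∀ {a b c d} → a ≤ b → c ≤ d → a * d + b * c ≤ a * c + b * d
  rearrangement {a} {b} {c} {d} a≤b c≤d = begin
    a * d + b * c
      ≡⟨ cong₂ (λ b d → a * d + b * c) (m+[n∸m]≡n a≤b) (m+[n∸m]≡n c≤d) ⟨
    a * (c + y) + (a + x) * c
      ≤⟨ m≤m+n _ (x * y) ⟩
    a * (c + y) + (a + x) * c + x * y
      ≡⟨ shuffle a x c y ⟩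
    a * c + (a + x) * (c + y)
      ≡⟨ cong₂ (λ b d → a * c + b * d) (m+[n∸m]≡n a≤b) (m+[n∸m]≡n c≤d) ⟩
    a * c + b * d ∎
    where
    x = b ∸ a
    y = d ∸ c
    shuffle : ∀ a x c y → a * (c + y) + (a + x) * c + x * y ≡ a * c + (a + x) * (c + y)
    shuffle = solve-∀

  power-rearrangement : ∀ k a b → a * b ^ k + b * a ^ k ≤ a * a ^ k + b * b ^ k
  power-rearrangement k a b with ≤-total a b
  ... | inj₁ a≤b = rearrangement a≤b (^-monoˡ-≤ k a≤b)
  ... | inj₂ b≤a = begin
    a * b ^ k + b * a ^ k ≡⟨ +-comm (a * b ^ k) _ ⟩
    b * a ^ k + a * b ^ k ≤⟨ rearrangement b≤a (^-monoˡ-≤ k b≤a) ⟩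
    b * b ^ k + a * a ^ k ≡⟨ +-comm (b * b ^ k) _ ⟩
    a * a ^ k + b * b ^ k ∎

  -- Chebyshev's sum inequality for the similarly ordered values `f x` and `f x ^ k`. In the
  -- induction the only new mixed terms pair the first entry with a later one, and
  -- `power-rearrangement` bounds each such pair.
  chebyshev : ∀ {A : Set} (xs : List A) (f : A → ℕ) k →
    ∑ xs f * ∑[ x ∈ xs ] (f x ^ k) ≤ length xs * ∑[ x ∈ xs ] (f x ^ suc k)
  chebyshev []       f k = z≤n
  chebyshev (x ∷ xs) f k = begin
    (a + S₁) * (p + Sₖ)
      ≡⟨ shuffle₁ a S₁ p Sₖ ⟩
    a * p + (a * Sₖ + p * S₁) + S₁ * Sₖ
      ≤⟨ +-mono-≤ (+-monoʳ-≤ (a * p) cross) (chebyshev xs f k) ⟩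
    a * p + (length xs * (a * p) + S) + length xs * S
      ≡⟨ shuffle₂ (length xs) (a * p) S ⟩
    suc (length xs) * (a * p + S)
      ∎
    where
    a p S₁ Sₖ S : ℕ
    a  = f x
    p  = f x ^ k
    S₁ = ∑ xs f
    Sₖ = ∑[ y ∈ xs ] (f y ^ k)
    S  = ∑[ y ∈ xs ] (f y ^ suc k)

    shuffle₁ : ∀ a s p t → (a + s) * (p + t) ≡ a * p + (a * t + p * s) + s * t
    shuffle₁ = solve-∀

    shuffle₂ : ∀ l q s → q + (l * q + s) + l * s ≡ suc l * (q + s)
    shuffle₂ = solve-∀

    cross : a * Sₖ + p * S₁ ≤ length xs * (a * p) + S
    cross = begin
      a * Sₖ + p * S₁
        ≡⟨ cong₂ _+_ (∑-*ˡ xs a _) (∑-*ˡ xs p f) ⟨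
      ∑[ y ∈ xs ] (a * f y ^ k) + ∑[ y ∈ xs ] (p * f y)
        ≡⟨ ∑-+ xs _ _ ⟨
      ∑[ y ∈ xs ] (a * f y ^ k + p * f y)
        ≡⟨ ∑-cong xs (λ y → cong (a * f y ^ k +_) (*-comm p (f y))) ⟩
      ∑[ y ∈ xs ] (a * f y ^ k + f y * p)
        ≤⟨ ∑-mono xs (λ {y} _ → power-rearrangement k a (f y)) ⟩
      ∑[ y ∈ xs ] (a * p + f y ^ suc k)
        ≡⟨ ∑-+ xs _ _ ⟩
      ∑[ y ∈ xs ] (a * p) + S
        ≡⟨ cong (_+ S) (∑-const xs (a * p)) ⟩
      length xs * (a * p) + S
        ∎

  -- Each induction step spends one factor `∑ xs f` on `chebyshev`, which raises the exponent under
  -- the sum by one at the price of a factor `length xs`.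
  power-mean : ∀ {A : Set} (xs : List A) (f : A → ℕ) k →
    ∑ xs f ^ suc k ≤ length xs ^ k * ∑[ x ∈ xs ] (f x ^ suc k)
  power-mean xs f zero = ≤-reflexive (begin-equality
    ∑ xs f * 1                        ≡⟨ *-comm _ 1 ⟩
    1 * ∑ xs f                        ≡⟨ cong (1 *_) (∑-cong xs (λ x → *-identityʳ (f x))) ⟨
    1 * ∑[ x ∈ xs ] (f x ^ 1)         ∎)
  power-mean xs f (suc k) = begin
    ∑ xs f * ∑ xs f ^ suc k
      ≤⟨ *-monoʳ-≤ (∑ xs f) (power-mean xs f k) ⟩
    ∑ xs f * (length xs ^ k * ∑[ x ∈ xs ] (f x ^ suc k))
      ≡⟨ shuffle (∑ xs f) (length xs ^ k) _ ⟩
    length xs ^ k * (∑ xs f * ∑[ x ∈ xs ] (f x ^ suc k))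
      ≤⟨ *-monoʳ-≤ (length xs ^ k) (chebyshev xs f (suc k)) ⟩
    length xs ^ k * (length xs * ∑[ x ∈ xs ] (f x ^ suc (suc k)))
      ≡⟨ shuffle′ (length xs ^ k) (length xs) _ ⟩
    length xs ^ suc k * ∑[ x ∈ xs ] (f x ^ suc (suc k))
      ∎
    where
    shuffle : ∀ a b c → a * (b * c) ≡ b * (a * c)
    shuffle = solve-∀
    shuffle′ : ∀ a b c → a * (b * c) ≡ b * a * c
    shuffle′ = solve-∀

  -- Convexity: between x and x + a the power grows by at most a times its derivative at the upper
  -- end.
  bernoulli : ∀ k x a → (x + a) ^ suc k ≤ x ^ suc k + suc k * a * (x + a) ^ k
  bernoulli zero    x a = ≤-reflexive (identity x a)
    where
    identity : ∀ x a → (x + a) * 1 ≡ x * 1 + 1 * a * 1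
    identity = solve-∀
  bernoulli (suc k) x a = begin
    (x + a) * P                                ≡⟨ *-distribʳ-+ P x a ⟩
    x * P + a * P                              ≤⟨ +-monoˡ-≤ (a * P) (*-monoʳ-≤ x (bernoulli k x a)) ⟩
    x * (x ^ suc k + suc k * a * Q) + a * P    ≡⟨ shuffle x (x ^ suc k) (suc k * a) Q (a * P) ⟩
    x ^ suc (suc k) + suc k * a * (x * Q) + a * P
      ≤⟨ +-monoˡ-≤ (a * P) (+-monoʳ-≤ (x ^ suc (suc k)) (*-monoʳ-≤ (suc k * a) (*-monoˡ-≤ Q (m≤m+n x a)))) ⟩
    x ^ suc (suc k) + suc k * a * P + a * P    ≡⟨ collect (x ^ suc (suc k)) (suc k) a P ⟩
    x ^ suc (suc k) + suc (suc k) * a * P      ∎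
    where
    P Q : ℕ
    P = (x + a) ^ suc k
    Q = (x + a) ^ k
    shuffle : ∀ x y c q r → x * (y + c * q) + r ≡ x * y + c * (x * q) + r
    shuffle = solve-∀
    collect : ∀ y l a p → y + l * a * p + a * p ≡ y + suc l * a * p
    collect = solve-∀

  -- For exponent k + 1, `bernoulli` bounds the loss by (k + 1) a N^k. If (M + 1)(k + 1) a ≤ N, then
  -- M + 1 times this loss is at most N^(k+1), which is the gap between the factors M + 1 and M.
  power-∸-approx : ∀ M k → ∃[ C ] (∀ N a → C * a ≤ N → M * N ^ k ≤ suc M * (N ∸ a) ^ k)
  power-∸-approx M zero    = 0 , λ N a _ → *-monoˡ-≤ 1 (n≤1+n M)
  power-∸-approx M (suc k) = suc M * suc k , bound
    where
    bound : ∀ N a → suc M * suc k * a ≤ N → M * N ^ suc k ≤ suc M * (N ∸ a) ^ suc k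
    bound N a Ca≤N = +-cancelʳ-≤ (N ^ suc k) _ _ (begin
      M * N ^ suc k + N ^ suc k
        ≡⟨ +-comm (M * N ^ suc k) _ ⟩
      suc M * N ^ suc k
        ≤⟨ *-monoʳ-≤ (suc M) expand ⟩
      suc M * ((N ∸ a) ^ suc k + suc k * a * N ^ k)
        ≡⟨ shuffle (suc M) ((N ∸ a) ^ suc k) (suc k) a (N ^ k) ⟩
      suc M * (N ∸ a) ^ suc k + suc M * suc k * a * N ^ k
        ≤⟨ +-monoʳ-≤ (suc M * (N ∸ a) ^ suc k) (*-monoˡ-≤ (N ^ k) Ca≤N) ⟩
      suc M * (N ∸ a) ^ suc k + N ^ suc k
        ∎)
      where
      shuffle : ∀ m y l a p → m * (y + l * a * p) ≡ m * y + m * l * a * p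
      shuffle = solve-∀

      a≤N : a ≤ N
      a≤N = ≤-trans (m≤m+n a _) Ca≤N

      expand : N ^ suc k ≤ (N ∸ a) ^ suc k + suc k * a * N ^ k
      expand = subst (λ z → z ^ suc k ≤ (N ∸ a) ^ suc k + suc k * a * z ^ k)
                     (m∸n+n≡m a≤N) (bernoulli k (N ∸ a) a)

  -- Lists without repetition, injective tuples and Turán's bound

  module _ {A : Set} where

    unique-⊆⇒length≤ : ∀ {xs ys : List A} → Unique xs → (∀ {x} → x ∈ xs → x ∈ ys) → length xs ≤ length ys
    unique-⊆⇒length≤ []                xs⊆ys = z≤n
    unique-⊆⇒length≤ {x ∷ xs} (x∉xs ∷ u) xs⊆ys with ∈-∃++ (xs⊆ys (here refl))
    ... | as , bs , refl = begin
      suc (length xs)         ≤⟨ s≤s (unique-⊆⇒length≤ u (λ z∈xs → drop-x as (All.lookup x∉xs z∈xs) (xs⊆ys (there z∈xs)))) ⟩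
      suc (length (as ++ bs)) ≡⟨ length-++-sucʳ as x bs ⟨
      length (as ++ x ∷ bs)   ∎
      where
      drop-x : ∀ as {z} → x ≢ z → z ∈ as ++ x ∷ bs → z ∈ as ++ bs
      drop-x []       x≢z (here z≡x) = contradiction (sym z≡x) x≢z
      drop-x []       x≢z (there z∈) = z∈
      drop-x (a ∷ as) x≢z (here z≡a) = here z≡a
      drop-x (a ∷ as) x≢z (there z∈) = there (drop-x as x≢z z∈)

    length-filter-mono : ∀ {P Q : A → Set} (P? : Decidable P) (Q? : Decidable Q) → (∀ {x} → P x → Q x) →
      ∀ xs → length (filter P? xs) ≤ length (filter Q? xs)
    length-filter-mono P? Q? P⇒Q xs = length-mono-≤ (filter⁺ P? Q? (λ { refl → P⇒Q }) (⊆-refl {x = xs}))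

    length-filter-split : ∀ {P : A → Set} (P? : Decidable P) xs →
      length xs ≡ length (filter P? xs) + length (filter (¬? ∘ P?) xs)
    length-filter-split P? []       = refl
    length-filter-split P? (x ∷ xs) with does (P? x)
    ... | true  = cong suc (length-filter-split P? xs)
    ... | false = trans (cong suc (length-filter-split P? xs)) (sym (+-suc _ _))

  -- Double counting of related pairs. The fibres may overlap, so only an inequality results.
  length≤∑-fibres : ∀ {A B : Set} {R : A → B → Set} (R? : ∀ x y → Dec (R x y)) xs ys →
    (∀ {x} → x ∈ xs → ∃[ y ] y ∈ ys × R x y) →
    length xs ≤ ∑[ y ∈ ys ] length (filter (λ x → R? x y) xs)
  length≤∑-fibres R? xs ys related = begin
    length xs                                       ≡⟨ *-identityʳ (length xs) ⟨
    length xs * 1                                   ≡⟨ ∑-const xs 1 ⟨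
    ∑[ x ∈ xs ] 1                                   ≤⟨ ∑-mono xs (λ {x} x∈xs → let y , y∈ys , Rxy = related x∈xs in
                                                         ∈-length (∈-filter⁺ (R? x) y∈ys Rxy)) ⟩
    ∑[ x ∈ xs ] length (filter (R? x) ys)           ≡⟨ ∑-length-filter-swap R? xs ys ⟩
    ∑[ y ∈ ys ] length (filter (λ x → R? x y) xs)   ∎

  module _ {A B C : Set} (f : A → B → C) where

    -- The second list may depend on the first entry. One construction thus serves both for tuples
    -- without repetition and for joining a tuple T with the embeddings found in its common
    -- neighbourhood.
    Σ-productWith : List A → (A → List B) → List C
    Σ-productWith xs g = concatMap (λ x → map (f x) (g x)) xs

    ∈-Σ-productWith⁻ : ∀ {z} xs g → z ∈ Σ-productWith xs g → ∃[ x ] ∃[ y ] x ∈ xs × y ∈ g x × z ≡ f x y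
    ∈-Σ-productWith⁻ xs g z∈ with ∈-concat⁻′ (map (λ x → map (f x) (g x)) xs) z∈
    ... | zs , z∈zs , zs∈ with ∈-map⁻ _ zs∈
    ... | x , x∈xs , refl with ∈-map⁻ (f x) z∈zs
    ... | y , y∈gx , refl = x , y , x∈xs , y∈gx , refl

    length-filter-Σ-productWith : ∀ {P : C → Set} (P? : Decidable P) xs g →
      length (filter P? (Σ-productWith xs g)) ≡ ∑[ x ∈ xs ] length (filter (P? ∘ f x) (g x))
    length-filter-Σ-productWith P? []       g = refl
    length-filter-Σ-productWith P? (x ∷ xs) g = begin-equality
      length (filter P? (map (f x) (g x) ++ Σ-productWith xs g))
        ≡⟨ cong length (filter-++ P? (map (f x) (g x)) _) ⟩
      length (filter P? (map (f x) (g x)) ++ filter P? (Σ-productWith xs g))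
        ≡⟨ length-++ (filter P? (map (f x) (g x))) ⟩
      length (filter P? (map (f x) (g x))) + length (filter P? (Σ-productWith xs g))
        ≡⟨ cong₂ _+_ (length-filter-map (g x)) (length-filter-Σ-productWith P? xs g) ⟩
      length (filter (P? ∘ f x) (g x)) + ∑[ x ∈ xs ] length (filter (P? ∘ f x) (g x))
        ∎
      where
      length-filter-map : ∀ ys → length (filter P? (map (f x) ys)) ≡ length (filter (P? ∘ f x) ys)
      length-filter-map []       = refl
      length-filter-map (y ∷ ys) with does (P? (f x y))
      ... | true  = cong suc (length-filter-map ys)
      ... | false = length-filter-map ys

    length-Σ-productWith : ∀ xs g → length (Σ-productWith xs g) ≡ ∑[ x ∈ xs ] length (g x)
    length-Σ-productWith []       g = refl
    length-Σ-productWith (x ∷ xs) g = trans (length-++ (map (f x) (g x)))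
      (cong₂ _+_ (length-map (f x) (g x)) (length-Σ-productWith xs g))

    Σ-productWith-unique : (∀ {w x y z} → f w y ≡ f x z → w ≡ x × y ≡ z) →
      ∀ {xs g} → Unique xs → (∀ x → Unique (g x)) → Unique (Σ-productWith xs g)
    Σ-productWith-unique f-inj {xs} {g} xs! g! = Unique.concat⁺
      (All.map⁺ (All.universal (λ x → Unique.map⁺ (proj₂ ∘ f-inj) (g! x)) xs))
      (AllPairs.map⁺ (AllPairs.map disjoint xs!))
      where
      disjoint : ∀ {w x} → w ≢ x → ∀ {z} → ¬ (z ∈ map (f w) (g w) × z ∈ map (f x) (g x))
      disjoint w≢x (z∈w , z∈x) with ∈-map⁻ _ z∈w | ∈-map⁻ _ z∈x
      ... | _ , _ , z≡ | _ , _ , z≡′ = w≢x (proj₁ (f-inj (trans (sym z≡) z≡′)))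

  module _ {N : ℕ} where

    private
      V : Set
      V = Fin N

    infixl 6 _∖_
    _∖_ : List V → V → List V
    W ∖ x = filter (λ y → ¬? (x ≟ y)) W

    tuples : ∀ s → List V → List (Vec V s)
    tuples zero    W = [] ∷ []
    tuples (suc s) W = Σ-productWith _∷_ W (λ x → tuples s (W ∖ x))

    tuples-unique : ∀ s {W} → Unique W → Unique (tuples s W)
    tuples-unique zero    W! = [] ∷ []
    tuples-unique (suc s) W! = Σ-productWith-unique _∷_ ∷-injective W!
      (λ x → tuples-unique s (Unique.filter⁺ (λ y → ¬? (x ≟ y)) W!))

    ∈-tuples⇒⊆ : ∀ s {W T} → T ∈ tuples s W → ∀ i → lookup T i ∈ W
    ∈-tuples⇒⊆ (suc s) {W} T∈ i with ∈-Σ-productWith⁻ _∷_ W _ T∈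
    ∈-tuples⇒⊆ (suc s) {W} T∈ zero    | x , T , x∈W , T∈′ , refl = x∈W
    ∈-tuples⇒⊆ (suc s) {W} T∈ (suc i) | x , T , x∈W , T∈′ , refl =
      proj₁ (∈-filter⁻ (λ y → ¬? (x ≟ y)) (∈-tuples⇒⊆ s T∈′ i))

    ∈-tuples⇒injective : ∀ s {W T} → T ∈ tuples s W → Injective _≡_ _≡_ (lookup T)
    ∈-tuples⇒injective (suc s) {W} T∈ {i} {j} eq with ∈-Σ-productWith⁻ _∷_ W _ T∈
    ... | x , T , x∈W , T∈′ , refl = inj i j eq
      where
      x≢ : ∀ j → x ≢ lookup T j
      x≢ j = proj₂ (∈-filter⁻ (λ y → ¬? (x ≟ y)) {xs = W} (∈-tuples⇒⊆ s T∈′ j))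

      inj : ∀ i j → lookup (x ∷ T) i ≡ lookup (x ∷ T) j → i ≡ j
      inj zero    zero    eq = refl
      inj zero    (suc j) eq = contradiction eq (x≢ j)
      inj (suc i) zero    eq = contradiction (sym eq) (x≢ i)
      inj (suc i) (suc j) eq = cong suc (∈-tuples⇒injective s T∈′ eq)

    length-tuples : ∀ s W → length (tuples s W) ≤ length W ^ s
    length-tuples zero    W = ≤-refl
    length-tuples (suc s) W = begin
      length (tuples (suc s) W)
        ≡⟨ length-Σ-productWith _∷_ W _ ⟩
      ∑[ x ∈ W ] length (tuples s (W ∖ x))
        ≤⟨ ∑-mono W (λ {x} _ → ≤-trans (length-tuples s (W ∖ x)) (^-monoˡ-≤ s (length-filter _ W))) ⟩
      ∑[ x ∈ W ] (length W ^ s)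
        ≡⟨ ∑-const W _ ⟩
      length W ^ suc s
        ∎

    length-filter-∖ : ∀ {P : V → Set} (P? : Decidable P) {W} x → Unique W →
      length (filter P? W) ≤ suc (length (filter P? (W ∖ x)))
    length-filter-∖ P? {W} x W! = unique-⊆⇒length≤ {ys = x ∷ _} (Unique.filter⁺ P? W!) ⊆-insert
      where
      ⊆-insert : ∀ {y} → y ∈ filter P? W → y ∈ x ∷ filter P? (W ∖ x)
      ⊆-insert {y} y∈ with x ≟ y | ∈-filter⁻ P? {xs = W} y∈
      ... | yes refl | _        = here refl
      ... | no x≢y   | y∈W , Py = there (∈-filter⁺ P? (∈-filter⁺ _ y∈W x≢y) Py)

    -- A chosen entry uses up at most one element satisfying `P`, so every factor of the falling
    -- factorial is at least the truncated difference. A pure power is kept because the power mean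
    -- inequality can be applied to it.
    length-filter-tuples : ∀ {P : V → Set} (P? : Decidable P) s {W} → Unique W →
      (length (filter P? W) ∸ s) ^ s ≤ length (filter (Vecᴬ.all? P?) (tuples s W))
    length-filter-tuples P? zero    W! = ≤-refl
    length-filter-tuples P? (suc s) {W} W! = begin
      (c ∸ suc s) * (c ∸ suc s) ^ s
        ≤⟨ *-monoˡ-≤ ((c ∸ suc s) ^ s) (m∸n≤m c (suc s)) ⟩
      c * (c ∸ suc s) ^ s
        ≡⟨ ∑-const (filter P? W) _ ⟨
      ∑[ x ∈ filter P? W ] ((c ∸ suc s) ^ s)
        ≤⟨ ∑-mono (filter P? W) (λ x∈ → extend (proj₂ (∈-filter⁻ P? {xs = W} x∈))) ⟩
      ∑[ x ∈ filter P? W ] length (filter (Vecᴬ.all? P? ∘ (x ∷_)) (tuples s (W ∖ x)))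
        -- The added summand collects the first entries outside `P`, which completes the sum to all
        -- of `W`.
        ≤⟨ m≤m+n _ _ ⟩
      _
        ≡⟨ ∑-filter-split P? W (λ x → length (filter (Vecᴬ.all? P? ∘ (x ∷_)) (tuples s (W ∖ x)))) ⟨
      ∑[ x ∈ W ] length (filter (Vecᴬ.all? P? ∘ (x ∷_)) (tuples s (W ∖ x)))
        ≡⟨ length-filter-Σ-productWith _∷_ (Vecᴬ.all? P?) W _ ⟨
      length (filter (Vecᴬ.all? P?) (tuples (suc s) W))
        ∎
      where
      c = length (filter P? W)

      extend : ∀ {x} → _ → (c ∸ suc s) ^ s ≤ length (filter (Vecᴬ.all? P? ∘ (x ∷_)) (tuples s (W ∖ x)))
      extend {x} Px = begin
        (c ∸ suc s) ^ s
          ≤⟨ ^-monoˡ-≤ s (∸-monoˡ-≤ (suc s) (length-filter-∖ P? x W!)) ⟩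
        (length (filter P? (W ∖ x)) ∸ s) ^ s
          ≤⟨ length-filter-tuples P? s (Unique.filter⁺ _ W!) ⟩
        length (filter (Vecᴬ.all? P?) (tuples s (W ∖ x)))
          ≤⟨ length-filter-mono _ _ (Px Vecᴬ.∷_) (tuples s (W ∖ x)) ⟩
        length (filter (Vecᴬ.all? P? ∘ (x ∷_)) (tuples s (W ∖ x)))
          ∎

  -- This is a²/n + b² ≥ (a + b)²/(n + 1) without division, where `S` bounds a²/n from above.
  -- Multiplied by n, the mixed terms are handled by 2 a (n b) ≤ a² + (n b)². For n = 0 the
  -- hypothesis forces a = 0.
  cauchy : ∀ n {a b S} → a * a ≤ n * S → (a + b) * (a + b) ≤ suc n * (S + b * b)
  cauchy zero    {suc a} ()
  cauchy zero    {zero} {b} {S} _ = ≤-trans (m≤n+m (b * b) S) (m≤m+n _ _)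
  cauchy (suc n) {a} {b} {S} a²≤nS = begin
    (a + b) * (a + b)                             ≡⟨ square a b ⟩
    a * a + b * b + (a * b + b * a)               ≤⟨ +-mono-≤ (+-monoˡ-≤ (b * b) a²≤nS) cross ⟩
    suc n * S + b * b + (S + suc n * (b * b))     ≡⟨ collect (suc n) S (b * b) ⟩
    suc (suc n) * (S + b * b)                     ∎
    where
    square : ∀ a b → (a + b) * (a + b) ≡ a * a + b * b + (a * b + b * a)
    square = solve-∀
    collect : ∀ m S q → m * S + q + (S + m * q) ≡ suc m * (S + q)
    collect = solve-∀
    scale : ∀ m a b → m * (a * b + b * a) ≡ a * (m * b) + m * b * a
    scale = solve-∀
    unscale : ∀ m S b → m * S + m * b * (m * b) ≡ m * (S + m * (b * b))
    unscale = solve-∀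

    cross : a * b + b * a ≤ S + suc n * (b * b)
    cross = *-cancelˡ-≤ (suc n) (begin
      suc n * (a * b + b * a)                     ≡⟨ scale (suc n) a b ⟩
      a * (suc n * b) + suc n * b * a             ≤⟨ square-rearrangement a (suc n * b) ⟩
      a * a + suc n * b * (suc n * b)             ≤⟨ +-monoˡ-≤ _ a²≤nS ⟩
      suc n * S + suc n * b * (suc n * b)         ≡⟨ unscale (suc n) S b ⟩
      suc n * (S + suc n * (b * b))               ∎)
      where
      square-rearrangement : ∀ a b → a * b + b * a ≤ a * a + b * b
      square-rearrangement a b = subst₂ (λ p q → a * p + b * q ≤ a * q + b * p)
        (*-identityʳ b) (*-identityʳ a) (power-rearrangement 1 a b)

  module _ {A : Set} {R : A → A → Set} (R? : ∀ x y → Dec (R x y)) (R-refl : ∀ {x} → R x x) where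

    private
      deg : List A → A → ℕ
      deg W u = length (filter (R? u) W)

    -- Greedy: a vertex u of minimum degree and its neighbourhood contribute
    -- at least (deg u)², and the non-neighbours of u are handled by induction.
    turán : ∀ n W → (∀ {I} → length I ≡ n → (∀ {x} → x ∈ I → x ∈ W) → ¬ AllPairs (λ x y → ¬ R x y) I) →
      length W * length W ≤ n * ∑ W (deg W)
    turán zero    W        indep = contradiction [] (indep refl (λ ()))
    turán (suc n) []       indep = z≤n
    turán (suc n) (w ∷ ws) indep = begin
      length W * length W                     ≡⟨ cong₂ _*_ split split ⟩
      (length W′ + deg W u) * (length W′ + deg W u)
        ≤⟨ cauchy n {length W′} {deg W u} (turán n W′ indep′) ⟩
      suc n * (∑ W′ (deg W′) + deg W u * deg W u)
        ≤⟨ *-monoʳ-≤ (suc n) (begin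
          ∑ W′ (deg W′) + deg W u * deg W u
            ≡⟨ cong (∑ W′ (deg W′) +_) (∑-const (filter (R? u) W) (deg W u)) ⟨
          ∑ W′ (deg W′) + ∑[ x ∈ filter (R? u) W ] deg W u
            ≤⟨ +-mono-≤ (∑-mono W′ (λ {x} _ → length-mono-≤ (filter⁺ (R? x) (R? x) (λ { refl p → p }) (filter-⊆ (¬? ∘ R? u) W))))
                        (∑-mono (filter (R? u) W) (λ x∈ → All.lookup u-min (proj₁ (∈-filter⁻ (R? u) {xs = W} x∈)))) ⟩
          ∑ W′ (deg W) + ∑ (filter (R? u) W) (deg W)
            ≡⟨ +-comm (∑ W′ (deg W)) _ ⟩
          ∑ (filter (R? u) W) (deg W) + ∑ W′ (deg W)
            ≡⟨ ∑-filter-split (R? u) W (deg W) ⟨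
          ∑ W (deg W)
            ∎) ⟩
      suc n * ∑ W (deg W)                     ∎
      where
      W : List A
      W = w ∷ ws
      u : A
      u = argmin (deg W) w ws
      W′ : List A
      W′ = filter (¬? ∘ R? u) W

      u-min : All (λ x → deg W u ≤ deg W x) W
      u-min = f[argmin]≤f[⊤] {f = deg W} w ws ∷ f[argmin]≤f[xs] {f = deg W} w ws

      u∈W : u ∈ W
      u∈W with argmin-sel (deg W) w ws
      ... | inj₁ u≡w  = here u≡w
      ... | inj₂ u∈ws = there u∈ws

      split : length W ≡ length W′ + deg W u
      split = trans (length-filter-split (R? u) W) (+-comm (deg W u) _)

      -- `u` is related to nothing in `W′`, so it extends any independent list found there; hence
      -- `n` drops by one.
      indep′ : ∀ {I} → length I ≡ n → (∀ {x} → x ∈ I → x ∈ W′) → ¬ AllPairs (λ x y → ¬ R x y) I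
      indep′ {I} ∣I∣≡n I⊆W′ I-indep = indep {u ∷ I} (cong suc ∣I∣≡n)
        (λ { (here refl) → u∈W ; (there x∈I) → proj₁ (∈-filter⁻ (¬? ∘ R? u) {xs = W} (I⊆W′ x∈I)) })
        (All.tabulate (λ x∈I → proj₂ (∈-filter⁻ (¬? ∘ R? u) {xs = W} (I⊆W′ x∈I))) ∷ I-indep)

  -- Common neighbourhoods

  fromList : ∀ {N} → List (Fin N) → Subset N
  fromList []       = ⊥
  fromList (x ∷ xs) = fromList xs [ x ]≔ inside

  ∈-fromList⁻ : ∀ {N} (xs : List (Fin N)) {y} → y ∈ₛ fromList xs → y ∈ xs
  ∈-fromList⁻ []       y∈ = ⊥-elim (∉⊥ y∈)
  ∈-fromList⁻ (x ∷ xs) {y} y∈ with y ≟ x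
  ... | yes y≡x = here y≡x
  ... | no  y≢x = there (∈-fromList⁻ xs (lookup⇒[]= y _
                    (trans (sym (lookup∘updateAt′ y x y≢x (fromList xs))) ([]=⇒lookup y∈))))

  ∣fromList∣ : ∀ {N} {xs : List (Fin N)} → Unique xs → ∣ fromList xs ∣ ≡ length xs
  ∣fromList∣ {N} []                = ∣⊥∣≡0 N
  ∣fromList∣ {xs = x ∷ xs} (x∉xs ∷ xs!) = trans
    (∣insert∣ (fromList xs) x (λ x∈ → All.lookup x∉xs (∈-fromList⁻ xs x∈) refl))
    (cong suc (∣fromList∣ xs!))
    where
    ∣insert∣ : ∀ {N} (p : Subset N) x → ¬ (x ∈ₛ p) → ∣ p [ x ]≔ inside ∣ ≡ suc ∣ p ∣
    ∣insert∣ (inside  ∷ p) zero    x∉p = contradiction Vec.here x∉p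
    ∣insert∣ (outside ∷ p) zero    x∉p = refl
    ∣insert∣ (inside  ∷ p) (suc x) x∉p = cong suc (∣insert∣ p x (x∉p ∘ Vec.there))
    ∣insert∣ (outside ∷ p) (suc x) x∉p = ∣insert∣ p x (x∉p ∘ Vec.there)

  module _ {N : ℕ} (G : Graph N) where

    open Graph G

    degreeIn : List (Fin N) → Fin N → ℕ
    degreeIn W u = length (filter (Adj? u) W)

    commonNeighbours : ∀ {s} → Vec (Fin N) s → List (Fin N) → List (Fin N)
    commonNeighbours T = filter (λ u → Vecᴬ.all? (Adj? u) T)

    module _ {n : ℕ} (noIndep : NoIndependentSetOfSize n G) {W : List (Fin N)} (W! : Unique W) where

      private
        w : ℕ
        w = length W

      -- `turán` is applied to closed neighbourhoods, whence the `suc`. A list that is independent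
      -- for the closed relation has no repetitions, so it yields a subset of exactly n vertices,
      -- which `noIndep` excludes.
      degree-sum : w * w ≤ n * ∑[ u ∈ W ] suc (degreeIn W u)
      degree-sum = ≤-trans (turán closed? (inj₁ refl) n W noIndepList)
        (*-monoʳ-≤ n (∑-mono W (λ {u} _ → closedDegree u)))
        where
        Closed : Fin N → Fin N → Set
        Closed u v = u ≡ v ⊎ Adj u v

        closed? : ∀ u v → Dec (Closed u v)
        closed? u v = (u ≟ v) ⊎-dec Adj? u v

        noIndepList : ∀ {I} → length I ≡ n → (∀ {x} → x ∈ I → x ∈ W) → ¬ AllPairs (λ x y → ¬ Closed x y) I
        noIndepList {I} ∣I∣≡n _ I-indep = noIndep (fromList I)
          (trans (∣fromList∣ (AllPairs.map (_∘ inj₁) I-indep)) ∣I∣≡n)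
          (λ x∈ y∈ → nonAdj I-indep (∈-fromList⁻ I x∈) (∈-fromList⁻ I y∈))
          where
          nonAdj : ∀ {I x y} → AllPairs (λ x y → ¬ Closed x y) I → x ∈ I → y ∈ I → ¬ Adj x y
          nonAdj (_ ∷ _)  (here refl) (here refl) = adj-irrefl refl
          nonAdj (px ∷ _) (here refl) (there y∈I) = All.lookup px y∈I ∘ inj₂
          nonAdj (px ∷ _) (there x∈I) (here refl) = All.lookup px x∈I ∘ inj₂ ∘ adj-sym
          nonAdj (_ ∷ ps) (there x∈I) (there y∈I) = nonAdj ps x∈I y∈I

        closedDegree : ∀ u → length (filter (closed? u) W) ≤ suc (degreeIn W u)
        closedDegree u = unique-⊆⇒length≤ {ys = u ∷ filter (Adj? u) W} (Unique.filter⁺ (closed? u) W!) ⊆-insert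
          where
          ⊆-insert : ∀ {v} → v ∈ filter (closed? u) W → v ∈ u ∷ filter (Adj? u) W
          ⊆-insert v∈ with ∈-filter⁻ (closed? u) {xs = W} v∈
          ... | _   , inj₁ refl = here refl
          ... | v∈W , inj₂ uv   = there (∈-filter⁺ (Adj? u) v∈W uv)

      -- Counting s-tuples of distinct neighbours costs s from each degree, and the closed
      -- neighbourhood accounts for one more; after the factor n these make up the `suc s * n` taken
      -- from w.
      excess-degree-sum : ∀ s → w * (w ∸ suc s * n) ≤ n * ∑[ u ∈ W ] (degreeIn W u ∸ s)
      excess-degree-sum s = begin
        w * (w ∸ suc s * n)     ≡⟨ *-distribˡ-∸ w w (suc s * n) ⟩
        w * w ∸ w * (suc s * n) ≤⟨ m≤n+o⇒m∸n≤o (w * w) (w * (suc s * n)) (begin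
          w * w
            ≤⟨ degree-sum ⟩
          n * ∑[ u ∈ W ] suc (degreeIn W u)
            ≤⟨ *-monoʳ-≤ n (∑-mono W (λ {u} _ → s≤s (m≤n+m∸n (degreeIn W u) s))) ⟩
          n * ∑[ u ∈ W ] (suc s + (degreeIn W u ∸ s))
            ≡⟨ cong (n *_) (trans (∑-+ W (λ _ → suc s) _) (cong (_+ excess) (∑-const W (suc s)))) ⟩
          n * (w * suc s + excess)
            ≡⟨ shuffle n w (suc s) excess ⟩
          w * (suc s * n) + n * excess
            ∎) ⟩
        n * excess              ∎
        where
        excess = ∑[ u ∈ W ] (degreeIn W u ∸ s)
        shuffle : ∀ n w s x → n * (w * s + x) ≡ w * (s * n) + n * x
        shuffle = solve-∀

      -- The sum counts pairs of a vertex u and a tuple T inside its neighbourhood. Counted from u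
      -- it is at least the sum of the powers (deg u - s)^s, and the power mean inequality over u
      -- leads back to `excess-degree-sum`.
      codegree-sum : ∀ k → let s = suc k in
        w * (w ∸ suc s * n) ^ s ≤ n ^ s * ∑[ T ∈ tuples s W ] length (commonNeighbours T W)
      codegree-sum k = cancel W refl
        where
        s x Q : ℕ
        s = suc k
        x = w ∸ suc s * n
        Q = ∑[ T ∈ tuples s W ] length (commonNeighbours T W)

        shuffle₁ : ∀ w p y → p * (w * y) ≡ w * p * y
        shuffle₁ = solve-∀
        shuffle₂ : ∀ m p q → m * (p * q) ≡ p * (m * q)
        shuffle₂ = solve-∀

        excess≤Q : ∑[ u ∈ W ] ((degreeIn W u ∸ s) ^ s) ≤ Q
        excess≤Q = begin
          ∑[ u ∈ W ] ((degreeIn W u ∸ s) ^ s)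
            ≤⟨ ∑-mono W (λ {u} _ → length-filter-tuples (Adj? u) s W!) ⟩
          ∑[ u ∈ W ] length (filter (Vecᴬ.all? (Adj? u)) (tuples s W))
            ≡⟨ ∑-length-filter-swap (λ u T → Vecᴬ.all? (Adj? u) T) W (tuples s W) ⟩
          Q
            ∎

        scaled : w ^ k * (w * x ^ s) ≤ w ^ k * (n ^ s * Q)
        scaled = begin
          w ^ k * (w * x ^ s)       ≡⟨ shuffle₁ w (w ^ k) (x ^ s) ⟩
          w ^ s * x ^ s             ≡⟨ ^-distribʳ-* s w x ⟨
          (w * x) ^ s               ≤⟨ ^-monoˡ-≤ s (excess-degree-sum s) ⟩
          (n * ∑[ u ∈ W ] (degreeIn W u ∸ s)) ^ s
            ≡⟨ ^-distribʳ-* s n _ ⟩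
          n ^ s * (∑[ u ∈ W ] (degreeIn W u ∸ s)) ^ s
            ≤⟨ *-monoʳ-≤ (n ^ s) (power-mean W (λ u → degreeIn W u ∸ s) k) ⟩
          n ^ s * (w ^ k * ∑[ u ∈ W ] ((degreeIn W u ∸ s) ^ s))
            ≤⟨ *-monoʳ-≤ (n ^ s) (*-monoʳ-≤ (w ^ k) excess≤Q) ⟩
          n ^ s * (w ^ k * Q)       ≡⟨ shuffle₂ (n ^ s) (w ^ k) Q ⟩
          w ^ k * (n ^ s * Q)       ∎

        -- The factor `w ^ k` can be cancelled only if `W` is nonempty; for empty `W` the left side
        -- vanishes.
        cancel : ∀ W′ → W′ ≡ W → w * x ^ s ≤ n ^ s * Q
        cancel []       refl = z≤n
        cancel (_ ∷ _)  refl = *-cancelˡ-≤ (w ^ k) {{m^n≢0 w k}} scaled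

      -- There are at most w^s tuples, so the power mean inequality over T turns the v-th power of
      -- `codegree-sum` into this bound. Hypothesis `approx` trades the (s + 1) n missing from w for
      -- the passage from M to M + 1.
      codegree-power-sum : ∀ M k t → let s = suc k ; v = suc t in
        M * w ^ (s * v) ≤ suc M * (w ∸ suc s * n) ^ (s * v) →
        M * w ^ (s + v) ≤ suc M * (n ^ (s * v) * ∑[ T ∈ tuples s W ] (length (commonNeighbours T W) ^ v))
      codegree-power-sum M k t approx = cancel W refl
        where
        s v x Q₁ Q : ℕ
        s = suc k
        v = suc t
        x = w ∸ suc s * n
        Q₁ = ∑[ T ∈ tuples s W ] length (commonNeighbours T W)
        Q  = ∑[ T ∈ tuples s W ] (length (commonNeighbours T W) ^ v)

        shuffle₁ : ∀ p M a b → p * (M * (a * b)) ≡ b * (M * (a * p))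
        shuffle₁ = solve-∀
        shuffle₂ : ∀ b m y → b * (m * y) ≡ m * (b * y)
        shuffle₂ = solve-∀
        shuffle₃ : ∀ m a p q → m * (a * (p * q)) ≡ p * (m * (a * q))
        shuffle₃ = solve-∀

        scaled : (w ^ s) ^ t * (M * w ^ (s + v)) ≤ (w ^ s) ^ t * (suc M * (n ^ (s * v) * Q))
        scaled = begin
          (w ^ s) ^ t * (M * w ^ (s + v))       ≡⟨ cong (λ z → (w ^ s) ^ t * (M * z)) (^-distribˡ-+-* w s v) ⟩
          (w ^ s) ^ t * (M * (w ^ s * w ^ v))   ≡⟨ shuffle₁ ((w ^ s) ^ t) M (w ^ s) (w ^ v) ⟩
          w ^ v * (M * (w ^ s) ^ v)             ≡⟨ cong (λ z → w ^ v * (M * z)) (^-*-assoc w s v) ⟩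
          w ^ v * (M * w ^ (s * v))             ≤⟨ *-monoʳ-≤ (w ^ v) approx ⟩
          w ^ v * (suc M * x ^ (s * v))         ≡⟨ shuffle₂ (w ^ v) (suc M) _ ⟩
          suc M * (w ^ v * x ^ (s * v))         ≡⟨ cong (λ z → suc M * (w ^ v * z)) (^-*-assoc x s v) ⟨
          suc M * (w ^ v * (x ^ s) ^ v)         ≡⟨ cong (suc M *_) (^-distribʳ-* v w (x ^ s)) ⟨
          suc M * (w * x ^ s) ^ v               ≤⟨ *-monoʳ-≤ (suc M) (^-monoˡ-≤ v (codegree-sum k)) ⟩
          suc M * (n ^ s * Q₁) ^ v              ≡⟨ cong (suc M *_) (^-distribʳ-* v (n ^ s) Q₁) ⟩
          suc M * ((n ^ s) ^ v * Q₁ ^ v)        ≡⟨ cong (λ z → suc M * (z * Q₁ ^ v)) (^-*-assoc n s v) ⟩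
          suc M * (n ^ (s * v) * Q₁ ^ v)
            ≤⟨ *-monoʳ-≤ (suc M) (*-monoʳ-≤ (n ^ (s * v)) (power-mean (tuples s W) (λ T → length (commonNeighbours T W)) t)) ⟩
          suc M * (n ^ (s * v) * (length (tuples s W) ^ t * Q))
            ≤⟨ *-monoʳ-≤ (suc M) (*-monoʳ-≤ (n ^ (s * v)) (*-monoˡ-≤ Q (^-monoˡ-≤ t (length-tuples s W)))) ⟩
          suc M * (n ^ (s * v) * ((w ^ s) ^ t * Q))
            ≡⟨ shuffle₃ (suc M) (n ^ (s * v)) ((w ^ s) ^ t) Q ⟩
          (w ^ s) ^ t * (suc M * (n ^ (s * v) * Q))
            ∎

        cancel : ∀ W′ → W′ ≡ W → M * w ^ (s + v) ≤ suc M * (n ^ (s * v) * Q)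
        cancel []       refl = ≤-trans (≤-reflexive (*-zeroʳ M)) z≤n
        cancel (_ ∷ _)  refl = *-cancelˡ-≤ ((w ^ s) ^ t) {{m^n≢0 (w ^ s) t {{m^n≢0 w s}}}} scaled

  -- Removing a colour class

  private
    variable
      r m : ℕ

  map₁-injective : ∀ {A B C : Set} {f : A → C} → Injective _≡_ _≡_ f →
    Injective _≡_ _≡_ (Sum.map₁ {B = B} f)
  map₁-injective f-inj {inj₁ _} {inj₁ _} eq   = cong inj₁ (f-inj (inj₁-injective eq))
  map₁-injective f-inj {inj₂ _} {inj₂ _} refl = refl

  map₂-injective : ∀ {A B C : Set} {f : B → C} → Injective _≡_ _≡_ f →
    Injective _≡_ _≡_ (Sum.map₂ {A = A} f)
  map₂-injective f-inj {inj₁ _} {inj₁ _} refl = refl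
  map₂-injective f-inj {inj₂ _} {inj₂ _} eq   = cong inj₂ (f-inj (inj₂-injective eq))

  -- Peel q c s c′: s entries of c equal q, and c′ lists the others in order.
  data Peel {r} (q : Fin r) : ∀ {m} → Vec (Fin r) m → ℕ → ∀ {v} → Vec (Fin r) v → Set where
    []   : Peel q [] 0 []
    take : ∀ {m s v} {c : Vec (Fin r) m} {c′ : Vec (Fin r) v} → Peel q c s c′ → Peel q (q ∷ c) (suc s) c′
    keep : ∀ {m s v} {c : Vec (Fin r) m} {c′ : Vec (Fin r) v} {x} → x ≢ q → Peel q c s c′ → Peel q (x ∷ c) s (x ∷ c′)

  peel : ∀ (q : Fin r) (c : Vec (Fin r) m) → ∃[ s ] ∃[ v ] Σ[ c′ ∈ Vec (Fin r) v ] Peel q c s c′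
  peel q []      = 0 , 0 , [] , []
  peel q (x ∷ c) with x ≟ q | peel q c
  ... | yes refl | _ , _ , _ , P = _ , _ , _ , take P
  ... | no x≢q   | _ , _ , _ , P = _ , _ , _ , keep x≢q P

  -- The degree of a vertex of colour `p` in the complete multipartite graph coloured by the vector.
  differing : Fin r → Vec (Fin r) m → ℕ
  differing p = Vec.count (λ x → ¬? (x ≟ p))

  -- The number of edges of that graph, each counted at its earlier endpoint.
  bichromaticPairs : Vec (Fin r) m → ℕ
  bichromaticPairs []      = 0
  bichromaticPairs (x ∷ c) = differing x c + bichromaticPairs c

  module _ {r} {q : Fin r} where

    peel-size : ∀ {m s v} {c : Vec (Fin r) m} {c′ : Vec (Fin r) v} → Peel q c s c′ → m ≡ s + v
    peel-size []                 = refl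
    peel-size (take P)           = cong suc (peel-size P)
    peel-size (keep {s = s} _ P) = trans (cong suc (peel-size P)) (sym (+-suc s _))

    differing-peeled : ∀ {m s v} {c : Vec (Fin r) m} {c′ : Vec (Fin r) v} → Peel q c s c′ → differing q c ≡ v
    differing-peeled []       = refl
    differing-peeled (take P) with q ≟ q
    ... | yes _   = differing-peeled P
    ... | no  q≢q = contradiction refl q≢q
    differing-peeled (keep {x = x} x≢q P) with x ≟ q
    ... | yes x≡q = contradiction x≡q x≢q
    ... | no  _   = cong suc (differing-peeled P)

    differing-other : ∀ {p} → q ≢ p → ∀ {m s v} {c : Vec (Fin r) m} {c′ : Vec (Fin r) v} → Peel q c s c′ →
      differing p c ≡ s + differing p c′
    differing-other q≢p []       = refl
    differing-other {p = p} q≢p (take P) with q ≟ p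
    ... | yes q≡p = contradiction q≡p q≢p
    ... | no  _   = cong suc (differing-other q≢p P)
    differing-other {p = p} q≢p (keep {s = s} {x = x} _ P) with x ≟ p
    ... | yes _   = differing-other q≢p P
    ... | no  _   = trans (cong suc (differing-other q≢p P)) (sym (+-suc s _))

    -- The term `s * v` counts the edges between the removed class and the rest: a removed entry
    -- meets the kept entries after it, a kept entry the removed ones after it.
    bichromaticPairs-peel : ∀ {m s v} {c : Vec (Fin r) m} {c′ : Vec (Fin r) v} → Peel q c s c′ →
      bichromaticPairs c ≡ s * v + bichromaticPairs c′
    bichromaticPairs-peel []       = refl
    bichromaticPairs-peel (take {s = s} {v = v} P) = trans
      (cong₂ _+_ (differing-peeled P) (bichromaticPairs-peel P)) (sym (+-assoc v (s * v) _))
    bichromaticPairs-peel (keep {s = s} {v = v} {c′ = c′} {x = x} x≢q P) = trans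
      (cong₂ _+_ (differing-other (x≢q ∘ sym) P) (bichromaticPairs-peel P))
      (shuffle s v (differing x c′) (bichromaticPairs c′))
      where
      shuffle : ∀ s v a b → (s + a) + (s * v + b) ≡ s * suc v + (a + b)
      shuffle = solve-∀

    position : ∀ {m s v} {c : Vec (Fin r) m} {c′ : Vec (Fin r) v} → Peel q c s c′ → Fin m → Fin s ⊎ Fin v
    position (take P)   zero    = inj₁ zero
    position (take P)   (suc i) = Sum.map₁ suc (position P i)
    position (keep _ P) zero    = inj₂ zero
    position (keep _ P) (suc i) = Sum.map₂ suc (position P i)

    position-injective : ∀ {m s v} {c : Vec (Fin r) m} {c′ : Vec (Fin r) v} (P : Peel q c s c′) →
      Injective _≡_ _≡_ (position P)
    position-injective (take P) {zero}  {zero}  eq = refl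
    position-injective (take P) {zero}  {suc j} eq with position P j
    position-injective (take P) {zero}  {suc j} () | inj₁ _
    position-injective (take P) {zero}  {suc j} () | inj₂ _
    position-injective (take P) {suc i} {zero}  eq with position P i
    position-injective (take P) {suc i} {zero}  () | inj₁ _
    position-injective (take P) {suc i} {zero}  () | inj₂ _
    position-injective (take P) {suc i} {suc j} eq =
      cong suc (position-injective P (map₁-injective Finₚ.suc-injective eq))
    position-injective (keep _ P) {zero}  {zero}  eq = refl
    position-injective (keep _ P) {zero}  {suc j} eq with position P j
    position-injective (keep _ P) {zero}  {suc j} () | inj₁ _
    position-injective (keep _ P) {zero}  {suc j} () | inj₂ _
    position-injective (keep _ P) {suc i} {zero}  eq with position P i
    position-injective (keep _ P) {suc i} {zero}  () | inj₁ _
    position-injective (keep _ P) {suc i} {zero}  () | inj₂ _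
    position-injective (keep _ P) {suc i} {suc j} eq =
      cong suc (position-injective P (map₂-injective Finₚ.suc-injective eq))

    lookup-peel : ∀ {m s v} {c : Vec (Fin r) m} {c′ : Vec (Fin r) v} (P : Peel q c s c′) i →
      lookup c i ≡ [ const q , lookup c′ ]′ (position P i)
    lookup-peel (take P)   zero    = refl
    lookup-peel (take P)   (suc i) with position P i | lookup-peel P i
    ... | inj₁ _ | eq = eq
    ... | inj₂ _ | eq = eq
    lookup-peel (keep _ P) zero    = refl
    lookup-peel (keep _ P) (suc i) with position P i | lookup-peel P i
    ... | inj₁ _ | eq = eq
    ... | inj₂ _ | eq = eq

    module _ {A : Set} where

      merge : ∀ {m s v} {c : Vec (Fin r) m} {c′ : Vec (Fin r) v} → Peel q c s c′ → Vec A s → Vec A v → Vec A m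
      merge []         T       φ       = []
      merge (take P)   (t ∷ T) φ       = t ∷ merge P T φ
      merge (keep _ P) T       (y ∷ φ) = y ∷ merge P T φ

      merge-injective : ∀ {m s v} {c : Vec (Fin r) m} {c′ : Vec (Fin r) v} (P : Peel q c s c′) {T T′ : Vec A s} {φ φ′ : Vec A v} →
        merge P T φ ≡ merge P T′ φ′ → T ≡ T′ × φ ≡ φ′
      merge-injective []         {[]}    {[]} {[]}    {[]}   eq = refl , refl
      merge-injective (take P)   {_ ∷ _} {_ ∷ _} eq with ∷-injective eq
      ... | refl , eq′ with merge-injective P eq′
      ... | refl , eq″ = refl , eq″
      merge-injective (keep _ P) {φ = _ ∷ _} {_ ∷ _} eq with ∷-injective eq
      ... | refl , eq′ with merge-injective P eq′
      ... | eq″ , refl = eq″ , refl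

      lookup-merge : ∀ {m s v} {c : Vec (Fin r) m} {c′ : Vec (Fin r) v} (P : Peel q c s c′) (T : Vec A s) φ i →
        lookup (merge P T φ) i ≡ [ lookup T , lookup φ ]′ (position P i)
      lookup-merge (take P)   (t ∷ T) φ       zero    = refl
      lookup-merge (take P)   (t ∷ T) φ       (suc i) with position P i | lookup-merge P T φ i
      ... | inj₁ _ | eq = eq
      ... | inj₂ _ | eq = eq
      lookup-merge (keep _ P) T       (y ∷ φ) zero    = refl
      lookup-merge (keep _ P) T       (y ∷ φ) (suc i) with position P i | lookup-merge P T φ i
      ... | inj₁ _ | eq = eq
      ... | inj₂ _ | eq = eq

  -- The order of removal, with colour `p` reserved for the end. The successors `suc s` and `suc v`
  -- record that neither the removed class nor the rest is empty, as the power mean inequality with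
  -- positive exponents requires.
  data Peeling {r} (p : Fin r) : ∀ {m} → Vec (Fin r) m → Set where
    monochromatic : ∀ {c : Vec (Fin r) m} → (∀ i → lookup c i ≡ p) → Peeling p c
    step          : ∀ {m s v q} {c : Vec (Fin r) m} {c′ : Vec (Fin r) (suc v)} → q ≢ p → Peel q c (suc s) c′ →
                    Peeling p c′ → Peeling p c

  peeling : ∀ (p : Fin r) m (c : Vec (Fin r) m) → ∃[ i ] lookup c i ≡ p → Peeling p c
  peeling {r} p = <-rec _ peeling′
    where
    peeling′ : ∀ m → (∀ {v} → v < m → (c : Vec (Fin r) v) → ∃[ i ] lookup c i ≡ p → Peeling p c) →
               (c : Vec (Fin r) m) → ∃[ i ] lookup c i ≡ p → Peeling p c
    peeling′ m rec c (i , ci≡p) with all? (λ j → lookup c j ≟ p)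
    ... | yes c≡p = monochromatic c≡p
    ... | no  c≢p with ¬∀⟶∃¬ m _ (λ j → lookup c j ≟ p) c≢p
    ... | j , cj≢p with peel (lookup c j) c
    -- Index `j` must land in the removed class, and `i`, which has colour `p`, among the kept
    -- entries; so both sizes are positive.
    ... | s , v , c′ , P with position P j in posj | lookup-peel P j | position P i in posi | lookup-peel P i
    ... | inj₂ j′ | eqj | _       | _   = contradiction refl (kept-≢ P j posj)
      where
      kept-≢ : ∀ {q m s v j′} {c : Vec (Fin r) m} {c′ : Vec (Fin r) v} (P : Peel q c s c′) j →
        position P j ≡ inj₂ j′ → lookup c j ≢ q
      kept-≢ (take P) (suc j) eq with position P j in posj
      kept-≢ (take P) (suc j) () | inj₁ _
      kept-≢ (take P) (suc j) eq | inj₂ _ = kept-≢ P j posj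
      kept-≢ (keep x≢q P) zero    eq = x≢q
      kept-≢ (keep x≢q P) (suc j) eq with position P j in posj
      kept-≢ (keep x≢q P) (suc j) () | inj₁ _
      kept-≢ (keep x≢q P) (suc j) eq | inj₂ _ = kept-≢ P j posj
    ... | inj₁ _  | _   | inj₁ _  | eqi = contradiction (trans (sym eqi) ci≡p) cj≢p
    peeling′ m rec c (i , ci≡p) | no _ | j , cj≢p | suc s , suc v , c′ , P | inj₁ _ | _ | inj₂ i′ | eqi =
      step cj≢p P (rec (≤-trans (s≤s (m≤n+m (suc v) s)) (≤-reflexive (sym (peel-size P)))) c′ (i′ , trans (sym eqi) ci≡p))

  -- Counting embeddings

  -- The colour classes of c are the parts of a complete multipartite graph on Fin m.
  IsEmbedding : ∀ {N} → Graph N → Vec (Fin r) m → List (Fin N) → Vec (Fin N) m → Set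
  IsEmbedding G c W φ =
    (∀ i → lookup φ i ∈ W) ×
    Injective _≡_ _≡_ (lookup φ) ×
    (∀ i j → lookup c i ≢ lookup c j → Graph.Adj G (lookup φ i) (lookup φ j))

  -- All values of `φ` are adjacent to all entries of `T`. This supplies the edges between the two
  -- classes of indices, and by irreflexivity also their distinctness; within `T` the colours agree
  -- and no edge is demanded.
  merge-isEmbedding : ∀ {s v N} (G : Graph N) {q : Fin r} {c : Vec (Fin r) m} {c′ : Vec (Fin r) v} (P : Peel q c s c′)
    {W T φ} → T ∈ tuples s W → IsEmbedding G c′ (commonNeighbours G T W) φ → IsEmbedding G c W (merge P T φ)
  merge-isEmbedding {s = s} {N = N} G {q} {c} {c′} P {W} {T} {φ} T∈ (φ∈ , φ-inj , φ-adj) =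
    (λ i → subst (_∈ W) (sym (lookup-merge P T φ i)) (in-W (position P i))) ,
    (λ {i} {j} eq → position-injective P (joint-injective (position P i) (position P j)
      (trans (sym (lookup-merge P T φ i)) (trans eq (lookup-merge P T φ j))))) ,
    (λ i j ci≢cj → subst₂ Adj (sym (lookup-merge P T φ i)) (sym (lookup-merge P T φ j))
      (adjacent (position P i) (position P j)
        (λ eq → ci≢cj (trans (lookup-peel P i) (trans eq (sym (lookup-peel P j)))))))
    where
    open Graph G

    value : Fin s ⊎ Fin _ → Fin N
    value = [ lookup T , lookup φ ]′

    split : ∀ j → lookup φ j ∈ W × Vecᴬ.All (Adj (lookup φ j)) T
    split j = ∈-filter⁻ (λ u → Vecᴬ.all? (Adj? u) T) (φ∈ j)

    in-W : ∀ a → value a ∈ W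
    in-W (inj₁ i) = ∈-tuples⇒⊆ s T∈ i
    in-W (inj₂ j) = proj₁ (split j)

    cross : ∀ i j → Adj (lookup φ j) (lookup T i)
    cross i j = Vecᴬ.lookup⁺ (proj₂ (split j)) i

    joint-injective : ∀ a b → value a ≡ value b → a ≡ b
    joint-injective (inj₁ i) (inj₁ j) eq = cong inj₁ (∈-tuples⇒injective s T∈ eq)
    joint-injective (inj₁ i) (inj₂ j) eq = contradiction (cross i j) (adj-irrefl (sym eq))
    joint-injective (inj₂ i) (inj₁ j) eq = contradiction (cross j i) (adj-irrefl eq)
    joint-injective (inj₂ i) (inj₂ j) eq = cong inj₂ (φ-inj eq)

    adjacent : ∀ a b → [ const q , lookup c′ ]′ a ≢ [ const q , lookup c′ ]′ b → Adj (value a) (value b)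
    adjacent (inj₁ i) (inj₁ j) q≢q = contradiction refl q≢q
    adjacent (inj₁ i) (inj₂ j) _   = adj-sym (cross i j)
    adjacent (inj₂ i) (inj₁ j) _   = cross j i
    adjacent (inj₂ i) (inj₂ j) c≢c = φ-adj i j c≢c

  -- The embeddings are kept as a duplicate-free list, since lists for different tuples have to be
  -- joined and finally sorted by their images. The field `error` lets the same record describe a
  -- common neighbourhood of any size.
  record ManyEmbeddings {N} (G : Graph N) (n : ℕ) (c : Vec (Fin r) m) (W : List (Fin N)) (M : ℕ) (error : ℕ) : Set where
    field
      embeddings   : List (Vec (Fin N) m)
      unique       : Unique embeddings
      isEmbedding  : ∀ {φ} → φ ∈ embeddings → IsEmbedding G c W φ
      many         : M * length W ^ m ≤ suc M * (n ^ bichromaticPairs c * length embeddings) + error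

  m≤m^1+n : ∀ m n → m ≤ m ^ suc n
  m≤m^1+n zero      n = z≤n
  m≤m^1+n m@(suc _) n = ≤-trans (≤-reflexive (sym (*-identityʳ m))) (*-monoʳ-≤ m (m^n>0 m n))

  -- Since X ≤ X^(v+1), the left side is at most w^s times the (v + 1)-st power of X C n^(s+d), and
  -- the threshold bounds that base by w.
  absorb-error : ∀ {X C n d s v w} → X * C * n ^ (s + d) ≤ w →
    X * (n ^ (s * suc v) * (w ^ s * (C * n ^ d) ^ suc v)) ≤ w ^ (s + suc v)
  absorb-error {X} {C} {n} {d} {s} {v} {w} large = begin
    X * (n ^ (s * suc v) * (w ^ s * (C * n ^ d) ^ suc v))
      ≡⟨ cong (λ z → X * (z * (w ^ s * (C * n ^ d) ^ suc v))) (^-*-assoc n s (suc v)) ⟨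
    X * ((n ^ s) ^ suc v * (w ^ s * (C * n ^ d) ^ suc v))
      ≤⟨ *-monoˡ-≤ _ (m≤m^1+n X v) ⟩
    X ^ suc v * ((n ^ s) ^ suc v * (w ^ s * (C * n ^ d) ^ suc v))
      ≡⟨ shuffle₁ (X ^ suc v) ((n ^ s) ^ suc v) (w ^ s) _ ⟩
    w ^ s * (X ^ suc v * ((n ^ s) ^ suc v * (C * n ^ d) ^ suc v))
      ≡⟨ cong (λ z → w ^ s * (X ^ suc v * z)) (^-distribʳ-* (suc v) (n ^ s) (C * n ^ d)) ⟨
    w ^ s * (X ^ suc v * (n ^ s * (C * n ^ d)) ^ suc v)
      ≡⟨ cong (w ^ s *_) (^-distribʳ-* (suc v) X (n ^ s * (C * n ^ d))) ⟨
    w ^ s * (X * (n ^ s * (C * n ^ d))) ^ suc v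
      ≡⟨ cong (λ z → w ^ s * z ^ suc v) (trans (shuffle₂ X (n ^ s) C (n ^ d)) (cong (X * C *_) (sym (^-distribˡ-+-* n s d)))) ⟩
    w ^ s * (X * C * n ^ (s + d)) ^ suc v
      ≤⟨ *-monoʳ-≤ (w ^ s) (^-monoˡ-≤ (suc v) large) ⟩
    w ^ s * w ^ suc v
      ≡⟨ ^-distribˡ-+-* w s (suc v) ⟨
    w ^ (s + suc v)
      ∎
    where
    shuffle₁ : ∀ x a w k → x * (a * (w * k)) ≡ w * (x * (a * k))
    shuffle₁ = solve-∀
    shuffle₂ : ∀ x a c b → x * (a * (c * b)) ≡ x * c * (a * b)
    shuffle₂ = solve-∀

  -- (1 − 1/(M+1))² − 1/(M+1)² = M₀/(M₀+1) for M = 2M₀ + 1.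
  combine : ∀ M₀ {Z A Q E ℓ B} → let M = suc (M₀ + M₀) in
    M * Z ≤ suc M * (A * Q) → M * Q ≤ suc M * (E * ℓ) + B → suc M * (A * B) ≤ Z →
    M₀ * Z ≤ suc M₀ * (A * E * ℓ)
  combine M₀ {Z} {A} {Q} {E} {ℓ} {B} h₁ h₂ h₃ =
    *-cancelˡ-≤ (4 * suc M₀) (+-cancelʳ-≤ Z _ _ (begin
      4 * suc M₀ * (M₀ * Z) + Z               ≡⟨ square M₀ Z ⟩
      M * (M * Z)                             ≤⟨ *-monoʳ-≤ M h₁ ⟩
      M * (suc M * (A * Q))                   ≡⟨ shuffle M (suc M) A Q ⟩
      suc M * (A * (M * Q))                   ≤⟨ *-monoʳ-≤ (suc M) (*-monoʳ-≤ A h₂) ⟩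
      suc M * (A * (suc M * (E * ℓ) + B))     ≡⟨ expand M₀ A E ℓ B ⟩
      4 * suc M₀ * (suc M₀ * (A * E * ℓ)) + suc M * (A * B)
                                              ≤⟨ +-monoʳ-≤ (4 * suc M₀ * (suc M₀ * (A * E * ℓ))) h₃ ⟩
      4 * suc M₀ * (suc M₀ * (A * E * ℓ)) + Z ∎))
    where
    M : ℕ
    M = suc (M₀ + M₀)
    square : ∀ m z → 4 * suc m * (m * z) + z ≡ suc (m + m) * (suc (m + m) * z)
    square = solve-∀
    shuffle : ∀ m m′ a q → m * (m′ * (a * q)) ≡ m′ * (a * (m * q))
    shuffle = solve-∀
    expand : ∀ m a e l b → suc (suc (m + m)) * (a * (suc (suc (m + m)) * (e * l) + b))
                         ≡ 4 * suc m * (suc m * (a * e * l)) + suc (suc (m + m)) * (a * b)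
    expand = solve-∀

  -- `M` is quantified after the peeling because the induction hypothesis is used at a finer
  -- precision. `C` depends on neither `n`, `G` nor `W`, so one constant serves all common
  -- neighbourhoods.
  many-embeddings : ∀ {p : Fin r} {c : Vec (Fin r) m} → Peeling p c → ∀ M →
    ∃[ C ] (∀ n .{{_ : NonZero n}} {N} (G : Graph N) → NoIndependentSetOfSize n G →
      ∀ {W} → Unique W → C * n ^ differing p c ≤ length W → ManyEmbeddings G n c W M 0)
  many-embeddings {m = m} {p} {c} (monochromatic c≡p) M with power-∸-approx M m
  ... | C , approx = C * m , λ n G _ {W} W! large → record
    { embeddings  = tuples m W
    ; unique      = tuples-unique m W!
    ; isEmbedding = λ φ∈ → ∈-tuples⇒⊆ m φ∈ , ∈-tuples⇒injective m φ∈ ,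
                           λ i j ci≢cj → contradiction (trans (c≡p i) (sym (c≡p j))) ci≢cj
    ; many        = begin
        M * length W ^ m
          ≤⟨ approx (length W) m (≤-trans (m≤m*n (C * m) (n ^ differing p c) {{m^n≢0 n (differing p c)}}) large) ⟩
        suc M * (length W ∸ m) ^ m
          ≤⟨ *-monoʳ-≤ (suc M) (falling W!) ⟩
        suc M * length (tuples m W)
          ≤⟨ *-monoʳ-≤ (suc M) (m≤n*m (length (tuples m W)) (n ^ bichromaticPairs c) {{m^n≢0 n (bichromaticPairs c)}}) ⟩
        suc M * (n ^ bichromaticPairs c * length (tuples m W))
          ≡⟨ +-identityʳ _ ⟨
        suc M * (n ^ bichromaticPairs c * length (tuples m W)) + 0
          ∎
    }
    where
    falling : ∀ {N} {W : List (Fin N)} → Unique W → (length W ∸ m) ^ m ≤ length (tuples m W)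
    falling {N} {W} W! = begin
      (length W ∸ m) ^ m
        ≡⟨ cong (λ z → (length z ∸ m) ^ m) (filter-all (λ _ → yes tt) (All.universal (λ _ → tt) W)) ⟨
      (length (filter (λ _ → yes tt) W) ∸ m) ^ m
        ≤⟨ length-filter-tuples (λ _ → yes tt) m W! ⟩
      length (filter (Vecᴬ.all? {P = λ _ → ⊤} (λ _ → yes tt)) (tuples m W))
        ≤⟨ length-filter _ (tuples m W) ⟩
      length (tuples m W)
        ∎
  many-embeddings {r = r} {m = m} {p} {c} (step {s = k} {v = t} {q = q} {c′ = c′} q≢p P rest) M₀
    -- Precision 2 M₀ + 1 for both estimates is what `combine` turns into M₀.
    with power-∸-approx (suc (M₀ + M₀)) (suc k * suc t) | many-embeddings rest (suc (M₀ + M₀))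
  ... | C₁ , approx | C₂ , embed = C , bound
    where
    s v d d′ e′ M X C : ℕ
    s  = suc k
    v  = suc t
    d  = differing p c
    d′ = differing p c′
    e′ = bichromaticPairs c′
    M  = suc (M₀ + M₀)
    -- The error carries a factor M from `extensions` and a factor M + 1 from `h₁`. In `C`, the
    -- first summand pays for the (s + 1) n subtracted from w, the second for this error.
    X  = suc M * M
    C  = C₁ * suc s + X * C₂

    d≡ : d ≡ s + d′
    d≡ = differing-other q≢p P

    e≡ : bichromaticPairs c ≡ s * v + e′
    e≡ = bichromaticPairs-peel P

    m≡ : m ≡ s + v
    m≡ = peel-size P

    bound : ∀ n .{{_ : NonZero n}} {N} (G : Graph N) → NoIndependentSetOfSize n G →
      ∀ {W} → Unique W → C * n ^ d ≤ length W → ManyEmbeddings G n c W M₀ 0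
    bound n {N} G noIndep {W} W! large = record
      { embeddings  = Σ-productWith (merge P) (tuples s W) (embeddings ∘ extensions)
      ; unique      = Σ-productWith-unique (merge P) (merge-injective P) (tuples-unique s W!) (unique ∘ extensions)
      ; isEmbedding = isEmb
      ; many        = begin
          M₀ * w ^ m                      ≡⟨ cong (λ z → M₀ * w ^ z) m≡ ⟩
          M₀ * w ^ (s + v)                ≤⟨ combine M₀ {A = n ^ (s * v)} {Q = Q} {E = n ^ e′} h₁ h₂ h₃ ⟩
          suc M₀ * (n ^ (s * v) * n ^ e′ * ℓ)
            ≡⟨ cong (λ z → suc M₀ * (z * ℓ)) (trans (cong (n ^_) e≡) (^-distribˡ-+-* n (s * v) e′)) ⟨
          suc M₀ * (n ^ bichromaticPairs c * ℓ)
            ≡⟨ cong (λ z → suc M₀ * (n ^ bichromaticPairs c * z)) (length-Σ-productWith (merge P) (tuples s W) _) ⟨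
          suc M₀ * (n ^ bichromaticPairs c * length (Σ-productWith (merge P) (tuples s W) (embeddings ∘ extensions)))
            ≡⟨ +-identityʳ _ ⟨
          suc M₀ * (n ^ bichromaticPairs c * length (Σ-productWith (merge P) (tuples s W) (embeddings ∘ extensions))) + 0
            ∎
      }
      where
      open ManyEmbeddings

      w K : ℕ
      w = length W
      K = (C₂ * n ^ d′) ^ v

      -- Common neighbourhoods below the threshold of the induction hypothesis are paid for by the error term.
      extensions : ∀ T → ManyEmbeddings G n c′ (commonNeighbours G T W) M (M * K)
      extensions T with C₂ * n ^ d′ ≤? length (commonNeighbours G T W)
      ... | yes big = record
        { embeddings  = embeddings ih
        ; unique      = unique ih
        ; isEmbedding = isEmbedding ih
        ; many        = ≤-trans (many ih) (+-monoʳ-≤ (suc M * (n ^ e′ * length (embeddings ih))) z≤n)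
        }
        where
        ih = embed n G noIndep (Unique.filter⁺ (λ u → Vecᴬ.all? (Graph.Adj? G u) T) W!) big
      ... | no small = record
        { embeddings  = []
        ; unique      = []
        ; isEmbedding = λ ()
        ; many        = ≤-trans (*-monoʳ-≤ M (^-monoˡ-≤ v (<⇒≤ (≰⇒> small)))) (m≤n+m (M * K) (suc M * (n ^ e′ * 0)))
        }

      Q ℓ : ℕ
      Q = ∑[ T ∈ tuples s W ] (length (commonNeighbours G T W) ^ v)
      ℓ = ∑[ T ∈ tuples s W ] length (embeddings (extensions T))

      isEmb : ∀ {φ} → φ ∈ Σ-productWith (merge P) (tuples s W) (embeddings ∘ extensions) → IsEmbedding G c W φ
      isEmb φ∈ with ∈-Σ-productWith⁻ (merge P) (tuples s W) _ φ∈
      ... | T , φ′ , T∈ , φ′∈ , refl = merge-isEmbedding G P {W} T∈ (isEmbedding (extensions T) φ′∈)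

      -- The exponent d = s + d′ is positive, so the threshold also dominates the linear loss (s +
      -- 1) n.
      n≤n^d : n ≤ n ^ d
      n≤n^d = ≤-trans (m≤m^1+n n (k + d′)) (≤-reflexive (cong (n ^_) (sym d≡)))

      h₁ : M * w ^ (s + v) ≤ suc M * (n ^ (s * v) * Q)
      h₁ = codegree-power-sum G noIndep W! M k t (approx w (suc s * n) (begin
        C₁ * (suc s * n)     ≡⟨ *-assoc C₁ (suc s) n ⟨
        C₁ * suc s * n       ≤⟨ *-mono-≤ (m≤m+n (C₁ * suc s) (X * C₂)) n≤n^d ⟩
        C * n ^ d            ≤⟨ large ⟩
        w                    ∎))

      h₂ : M * Q ≤ suc M * (n ^ e′ * ℓ) + w ^ s * (M * K)
      h₂ = begin
        M * Q
          ≡⟨ ∑-*ˡ (tuples s W) M _ ⟨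
        ∑[ T ∈ tuples s W ] (M * length (commonNeighbours G T W) ^ v)
          ≤⟨ ∑-mono (tuples s W) (λ {T} _ → many (extensions T)) ⟩
        ∑[ T ∈ tuples s W ] (suc M * (n ^ e′ * length (embeddings (extensions T))) + M * K)
          ≡⟨ ∑-+ (tuples s W) _ _ ⟩
        ∑[ T ∈ tuples s W ] (suc M * (n ^ e′ * length (embeddings (extensions T)))) + ∑[ T ∈ tuples s W ] (M * K)
          ≡⟨ cong₂ _+_ (trans (∑-*ˡ (tuples s W) (suc M) _) (cong (suc M *_) (∑-*ˡ (tuples s W) (n ^ e′) _)))
                       (∑-const (tuples s W) (M * K)) ⟩
        suc M * (n ^ e′ * ℓ) + length (tuples s W) * (M * K)
          ≤⟨ +-monoʳ-≤ (suc M * (n ^ e′ * ℓ)) (*-monoˡ-≤ (M * K) (length-tuples s W)) ⟩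
        suc M * (n ^ e′ * ℓ) + w ^ s * (M * K)
          ∎

      h₃ : suc M * (n ^ (s * v) * (w ^ s * (M * K))) ≤ w ^ (s + v)
      h₃ = begin
        suc M * (n ^ (s * v) * (w ^ s * (M * K)))
          ≡⟨ shuffle (suc M) (n ^ (s * v)) (w ^ s) M K ⟩
        X * (n ^ (s * v) * (w ^ s * K))
          ≤⟨ absorb-error {X} {C₂} {n} {d′} {s} {t} (begin
            X * C₂ * n ^ (s + d′)   ≡⟨ cong (λ z → X * C₂ * n ^ z) d≡ ⟨
            X * C₂ * n ^ d          ≤⟨ *-monoˡ-≤ (n ^ d) (m≤n+m (X * C₂) (C₁ * suc s)) ⟩
            C * n ^ d               ≤⟨ large ⟩
            w                       ∎) ⟩
        w ^ (s + v)
          ∎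
        where
        shuffle : ∀ l a b m k → l * (a * (b * (m * k))) ≡ l * m * (a * (b * k))
        shuffle = solve-∀

  -- Copies and automorphisms

  module _ {n : ℕ} {P : Fin n → Set} (P? : Decidable P) where

    ∈-comprehension⁺ : ∀ {i} → P i → i ∈ₛ tabulate (does ∘ P?)
    ∈-comprehension⁺ {i} Pi = lookup⇒[]= i _ (trans (lookup∘tabulate (does ∘ P?) i) (dec-true (P? i) Pi))

    ∈-comprehension⁻ : ∀ {i} → i ∈ₛ tabulate (does ∘ P?) → P i
    ∈-comprehension⁻ {i} i∈ with P? i | trans (sym (lookup∘tabulate (does ∘ P?) i)) ([]=⇒lookup i∈)
    ... | yes Pi | _  = Pi
    ... | no _   | ()

  module _ {k N : ℕ} (H : Graph k) (G : Graph N) where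

    open Graph

    IsInjectiveHomomorphism : Vec (Fin N) k → Set
    IsInjectiveHomomorphism φ =
      Injective _≡_ _≡_ (lookup φ) × (∀ a b → Adj H a b → Adj G (lookup φ a) (lookup φ b))

    private
      inRange? : ∀ (φ : Vec (Fin N) k) v → Dec (∃[ a ] lookup φ a ≡ v)
      inRange? φ v = any? (λ a → lookup φ a ≟ v)

      imageEdge? : ∀ (φ : Vec (Fin N) k) i j → Dec (∃[ a ] ∃[ b ] lookup φ a ≡ i × lookup φ b ≡ j × Adj H a b)
      imageEdge? φ i j = any? (λ a → any? (λ b → (lookup φ a ≟ i) ×-dec (lookup φ b ≟ j) ×-dec Adj? H a b))

      row : Vec (Fin N) k → Fin N → Subset N
      row φ i = tabulate (does ∘ imageEdge? φ i)

    -- Only edges coming from `H` are kept, since copies need not be induced.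
    image : Vec (Fin N) k → Sub N
    image φ = tabulate (does ∘ inRange? φ) , tabulate (row φ)

    private
      edge⁻ : ∀ φ {i j} → j ∈ₛ lookup (proj₂ (image φ)) i → ∃[ a ] ∃[ b ] lookup φ a ≡ i × lookup φ b ≡ j × Adj H a b
      edge⁻ φ {i} {j} j∈ = ∈-comprehension⁻ (imageEdge? φ i) (subst (j ∈ₛ_) (lookup∘tabulate (row φ) i) j∈)

      edge⁺ : ∀ φ {i j} → ∃[ a ] ∃[ b ] lookup φ a ≡ i × lookup φ b ≡ j × Adj H a b → j ∈ₛ lookup (proj₂ (image φ)) i
      edge⁺ φ {i} {j} e = subst (j ∈ₛ_) (sym (lookup∘tabulate (row φ) i)) (∈-comprehension⁺ (imageEdge? φ i) e)

    image-isSubgraph : ∀ {φ} → IsInjectiveHomomorphism φ → IsSubgraph G (image φ)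
    image-isSubgraph {φ} (φ-inj , φ-hom) =
      (λ i j j∈ → let a , b , φa≡i , φb≡j , ab = edge⁻ φ j∈ in edge⁺ φ (b , a , φb≡j , φa≡i , adj-sym H ab)) ,
      (λ i j j∈ → let a , b , φa≡i , φb≡j , ab = edge⁻ φ j∈ in
        ∈-comprehension⁺ (inRange? φ) (a , φa≡i) ,
        ∈-comprehension⁺ (inRange? φ) (b , φb≡j) ,
        subst₂ (Adj G) φa≡i φb≡j (φ-hom a b ab))

    image-isIsomorphism : ∀ {φ} → IsInjectiveHomomorphism φ → IsIsomorphism H (image φ) φ
    image-isIsomorphism {φ} (φ-inj , φ-hom) =
      φ-inj ,
      (λ v → mk⇔ (∈-comprehension⁻ (inRange? φ)) (∈-comprehension⁺ (inRange? φ))) ,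
      (λ a b → mk⇔
        (λ ab → edge⁺ φ (a , b , refl , refl , ab))
        (λ b∈ → let a′ , b′ , φa′≡ , φb′≡ , ab = edge⁻ φ b∈ in subst₂ (Adj H) (φ-inj φa′≡) (φ-inj φb′≡) ab))

    -- Relative to the fixed `φ₀`, every isomorphism onto `S` is `φ₀` after an automorphism σ of
    -- `H`: the two maps have the same range, so σ sends a to the preimage of `lookup φ a` under
    -- `φ₀`.
    isomorphisms≤∣Aut∣ : ∀ S {φ₀} → IsIsomorphism H S φ₀ → ∀ {L} → Unique L →
      length (filter (isIsomorphism? H S) L) ≤ ∣Aut H ∣
    isomorphisms≤∣Aut∣ S {φ₀} (φ₀-inj , φ₀-range , φ₀-adj) {L} L! = begin
      length (filter (isIsomorphism? H S) L)   ≤⟨ unique-⊆⇒length≤ (Unique.filter⁺ (isIsomorphism? H S) L!) factor ⟩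
      length (map compose automorphisms)       ≡⟨ length-map compose automorphisms ⟩
      ∣Aut H ∣                                  ∎
      where
      automorphisms : List (Vec (Fin k) k)
      automorphisms = filter (isAutomorphism? H) (elems (vecs (fins k) k))

      compose : Vec (Fin k) k → Vec (Fin N) k
      compose σ = tabulate (lookup φ₀ ∘ lookup σ)

      factor : ∀ {φ} → φ ∈ filter (isIsomorphism? H S) L → φ ∈ map compose automorphisms
      factor {φ} φ∈ with ∈-filter⁻ (isIsomorphism? H S) {xs = L} φ∈
      ... | _ , φ-inj , φ-range , φ-adj =
        subst (_∈ map compose automorphisms) φ₀∘σ≡φ
          (∈-map⁺ compose (∈-filter⁺ (isAutomorphism? H) (complete (vecs (fins k) k) σ) σ-auto))
        where
        preimage : ∀ a → ∃[ b ] lookup φ₀ b ≡ lookup φ a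
        preimage a = to (φ₀-range (lookup φ a)) (from (φ-range (lookup φ a)) (a , refl))

        σ : Vec (Fin k) k
        σ = tabulate (proj₁ ∘ preimage)

        φ₀σ : ∀ a → lookup φ₀ (lookup σ a) ≡ lookup φ a
        φ₀σ a = trans (cong (lookup φ₀) (lookup∘tabulate (proj₁ ∘ preimage) a)) (proj₂ (preimage a))

        φ₀∘σ≡φ : compose σ ≡ φ
        φ₀∘σ≡φ = trans (tabulate-cong φ₀σ) (tabulate∘lookup φ)

        σ-surjective : ∀ b → ∃[ a ] lookup σ a ≡ b
        σ-surjective b with to (φ-range (lookup φ₀ b)) (from (φ₀-range (lookup φ₀ b)) (b , refl))
        ... | a , φa≡φ₀b = a , φ₀-inj (trans (φ₀σ a) φa≡φ₀b)

        Edge : Fin N → Fin N → Set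
        Edge x y = y ∈ₛ lookup (proj₂ S) x

        σ-auto : IsAutomorphism H σ
        σ-auto =
          ( (λ {a} {b} eq → φ-inj (trans (sym (φ₀σ a)) (trans (cong (lookup φ₀) eq) (φ₀σ b))))
          , (λ b → proj₁ (σ-surjective b) , λ { refl → proj₂ (σ-surjective b) })) ,
          (λ a b → mk⇔
            (λ ab → from (φ₀-adj _ _) (subst₂ Edge (sym (φ₀σ a)) (sym (φ₀σ b)) (to (φ-adj a b) ab)))
            (λ σab → from (φ-adj a b) (subst₂ Edge (φ₀σ a) (φ₀σ b) (to (φ₀-adj _ _) σab))))

    -- Each map in `L` is an isomorphism onto its image, which is a copy; `isomorphisms≤∣Aut∣`
    -- bounds the fibre over each copy.
    injectiveHomomorphisms≤copies*∣Aut∣ : ∀ {L} → Unique L → (∀ {φ} → φ ∈ L → IsInjectiveHomomorphism φ) →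
      length L ≤ copies H G * ∣Aut H ∣
    injectiveHomomorphisms≤copies*∣Aut∣ {L} L! L-hom = begin
      length L
        ≤⟨ length≤∑-fibres (λ φ S → isIsomorphism? H S φ) L copyList (λ {φ} φ∈ → let h = L-hom {φ} φ∈ in
             image φ ,
             ∈-filter⁺ (isCopy? H G) (complete (subs N) (image φ)) (image-isSubgraph {φ} h , φ , image-isIsomorphism {φ} h) ,
             image-isIsomorphism {φ} h) ⟩
      ∑[ S ∈ copyList ] length (filter (isIsomorphism? H S) L)
        ≤⟨ ∑-mono copyList (λ {S} S∈ →
             let _ , _ , φ₀ , φ₀-iso = ∈-filter⁻ (isCopy? H G) {xs = elems (subs N)} S∈ in
             isomorphisms≤∣Aut∣ S {φ₀} φ₀-iso L!) ⟩
      ∑[ S ∈ copyList ] ∣Aut H ∣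
        ≡⟨ ∑-const copyList ∣Aut H ∣ ⟩
      copies H G * ∣Aut H ∣
        ∎
      where
      copyList : List (Sub N)
      copyList = filter (isCopy? H G) (elems (subs N))

  -- Edge count and minimum degree of a complete multipartite graph

  count≡length-filter : ∀ {A B : Set} {P : A → Set} {Q : B → Set} (P? : Decidable P) (Q? : Decidable Q) {m}
    (c : Vec A m) (f : Fin m → B) → (∀ i → does (P? (lookup c i)) ≡ does (Q? (f i))) →
    Vec.count P? c ≡ length (filter Q? (List.tabulate f))
  count≡length-filter P? Q? []      f P≡Q = refl
  -- The function `f` is arbitrary because the tail of `allFin` is a tabulation of `suc`, to which
  -- the induction has to apply.
  count≡length-filter P? Q? (x ∷ c) f P≡Q
    with does (P? x) | does (Q? (f zero)) | P≡Q zero | count≡length-filter P? Q? c (f ∘ suc) (P≡Q ∘ suc)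
  ... | true  | .true  | refl | eq = cong suc eq
  ... | false | .false | refl | eq = eq

  differing≡length-filter : ∀ {r m} (p : Fin r) (c : Vec (Fin r) m) →
    differing p c ≡ length (filter (λ i → ¬? (lookup c i ≟ p)) (allFin m))
  differing≡length-filter p c = count≡length-filter (λ x → ¬? (x ≟ p)) (λ i → ¬? (lookup c i ≟ p)) c (λ i → i) (λ _ → refl)

  module _ {r : ℕ} where

    -- Lists the pairs behind the recursive number `bichromaticPairs`, so that they can be found
    -- among the ordered edges counted by `edgeCount`.
    bichromatic : ∀ {m} → Vec (Fin r) m → List (Fin m × Fin m)
    bichromatic []              = []
    bichromatic {suc m} (x ∷ c) =
      map (λ j → zero , suc j) (filter (λ j → ¬? (lookup c j ≟ x)) (allFin m)) ++
      map (λ (i , j) → suc i , suc j) (bichromatic c)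

    length-bichromatic : ∀ {m} (c : Vec (Fin r) m) → length (bichromatic c) ≡ bichromaticPairs c
    length-bichromatic []              = refl
    length-bichromatic {suc m} (x ∷ c) = trans (length-++ (map _ (filter (λ j → ¬? (lookup c j ≟ x)) (allFin m))))
      (cong₂ _+_ (trans (length-map _ (filter (λ j → ¬? (lookup c j ≟ x)) (allFin m))) (sym (differing≡length-filter x c)))
                 (trans (length-map _ (bichromatic c)) (length-bichromatic c)))

    bichromatic-unique : ∀ {m} (c : Vec (Fin r) m) → Unique (bichromatic c)
    bichromatic-unique []              = []
    bichromatic-unique {suc m} (x ∷ c) = Unique.++⁺
      (Unique.map⁺ (λ eq → Finₚ.suc-injective (,-injectiveʳ eq)) (Unique.filter⁺ (λ j → ¬? (lookup c j ≟ x)) (Unique.allFin⁺ m)))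
      (Unique.map⁺ (λ { {i , j} {i′ , j′} refl → refl }) (bichromatic-unique c))
      disjoint
      where
      disjoint : ∀ {e} → ¬ (e ∈ map (λ j → zero , suc j) (filter (λ j → ¬? (lookup c j ≟ x)) (allFin m)) ×
                            e ∈ map (λ (i , j) → suc i , suc j) (bichromatic c))
      disjoint (e∈₁ , e∈₂) with ∈-map⁻ _ e∈₁ | ∈-map⁻ _ e∈₂
      ... | _ , _ , refl | _ , _ , ()

    ∈-bichromatic⁻ : ∀ {m} (c : Vec (Fin r) m) {i j} → (i , j) ∈ bichromatic c → i <ᶠ j × lookup c i ≢ lookup c j
    ∈-bichromatic⁻ {suc m} (x ∷ c) e∈ with ∈-++⁻ (map _ (filter (λ j → ¬? (lookup c j ≟ x)) (allFin m))) e∈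
    ... | inj₁ e∈₁ with ∈-map⁻ _ e∈₁
    ...   | j , j∈ , refl = z<s , λ eq → proj₂ (∈-filter⁻ (λ j → ¬? (lookup c j ≟ x)) {xs = allFin m} j∈) (sym eq)
    ∈-bichromatic⁻ {suc m} (x ∷ c) e∈ | inj₂ e∈₂ with ∈-map⁻ _ e∈₂
    ...   | (i , j) , e∈′ , refl = let i<j , ci≢cj = ∈-bichromatic⁻ c e∈′ in s<s i<j , ci≢cj

  module _ {k r : ℕ} (H : Graph k) (c : Vec (Fin r) k) (adj : ∀ i j → lookup c i ≢ lookup c j → Graph.Adj H i j) where

    bichromaticPairs≤edgeCount : bichromaticPairs c ≤ edgeCount H
    bichromaticPairs≤edgeCount = begin
      bichromaticPairs c        ≡⟨ length-bichromatic c ⟨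
      length (bichromatic c)    ≤⟨ unique-⊆⇒length≤ (bichromatic-unique c) (λ {e} e∈ →
                                     let i<j , ci≢cj = ∈-bichromatic⁻ c e∈ in
                                     ∈-filter⁺ _ (complete (pairs (fins k) (fins k)) e) (i<j , adj _ _ ci≢cj)) ⟩
      edgeCount H               ∎

    differing≤degree : ∀ v → differing (lookup c v) c ≤ degree H v
    differing≤degree v = begin
      differing (lookup c v) c                                          ≡⟨ differing≡length-filter (lookup c v) c ⟩
      length (filter (λ i → ¬? (lookup c i ≟ lookup c v)) (allFin k))   ≤⟨ length-filter-mono _ (Graph.Adj? H v) (λ ≢ → adj v _ (≢ ∘ sym)) (allFin k) ⟩
      degree H v                                                        ∎

  foldr₁-⊓-sel : ∀ {n} (xs : Vec ℕ (suc n)) → ∃[ i ] Vec.foldr₁ _⊓_ xs ≡ lookup xs i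
  foldr₁-⊓-sel (x ∷ [])     = zero , refl
  foldr₁-⊓-sel (x ∷ y ∷ ys) with ⊓-sel x (Vec.foldr₁ _⊓_ (y ∷ ys)) | foldr₁-⊓-sel (y ∷ ys)
  ... | inj₁ eq | _       = zero , eq
  ... | inj₂ eq | i , eq′ = suc i , trans eq eq′

  δ-attained : ∀ {k} (H : Graph (suc k)) → ∃[ v ] δ H ≡ degree H v
  δ-attained H with foldr₁-⊓-sel (tabulate (degree H))
  ... | v , eq = v , trans eq (lookup∘tabulate (degree H) v)

  -- The theorem without division, from `many-embeddings` on the list of all vertices. Adjacency in
  -- `H` means different parts, so the embeddings are injective homomorphisms. Both comparisons of
  -- exponents rely on n ≥ 1.
  many-copies : ∀ {k} (H : Graph (suc k)) → CompleteMultipartite H → ∀ M →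
    ∃[ C ] (∀ n .{{_ : NonZero n}} {N} (G : Graph N) → NoIndependentSetOfSize n G → C * n ^ δ H ≤ N →
      M * N ^ suc k ≤ suc M * (∣Aut H ∣ * n ^ edgeCount H * copies H G))
  many-copies {k} H (r , part , _ , adj⇔) M with δ-attained H
  ... | v , δ≡ with many-embeddings (peeling (lookup (tabulate part) v) _ (tabulate part) (v , refl)) M
  ...   | C , embed = C , bound
    where
    c : Vec (Fin r) (suc k)
    c = tabulate part

    adj : ∀ i j → lookup c i ≢ lookup c j → Graph.Adj H i j
    adj i j ci≢cj = from (adj⇔ i j) (subst₂ _≢_ (lookup∘tabulate part i) (lookup∘tabulate part j) ci≢cj)

    adj⁻ : ∀ i j → Graph.Adj H i j → lookup c i ≢ lookup c j
    adj⁻ i j ij = subst₂ _≢_ (sym (lookup∘tabulate part i)) (sym (lookup∘tabulate part j)) (to (adj⇔ i j) ij)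

    bound : ∀ n .{{_ : NonZero n}} {N} (G : Graph N) → NoIndependentSetOfSize n G → C * n ^ δ H ≤ N →
      M * N ^ suc k ≤ suc M * (∣Aut H ∣ * n ^ edgeCount H * copies H G)
    bound n {N} G noIndep large = begin
      M * N ^ suc k
        ≡⟨ cong (λ z → M * z ^ suc k) ∣allFin∣ ⟨
      M * length (allFin N) ^ suc k
        ≤⟨ many ⟩
      suc M * (n ^ bichromaticPairs c * length embeddings) + 0
        ≡⟨ +-identityʳ _ ⟩
      suc M * (n ^ bichromaticPairs c * length embeddings)
        ≤⟨ *-monoʳ-≤ (suc M) (*-mono-≤ (^-monoʳ-≤ n (bichromaticPairs≤edgeCount H c adj))
             (injectiveHomomorphisms≤copies*∣Aut∣ H G unique
               (λ φ∈ → let _ , φ-inj , φ-adj = isEmbedding φ∈ in φ-inj , λ a b ab → φ-adj a b (adj⁻ a b ab)))) ⟩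
      suc M * (n ^ edgeCount H * (copies H G * ∣Aut H ∣))
        ≡⟨ cong (suc M *_) (shuffle (n ^ edgeCount H) (copies H G) ∣Aut H ∣) ⟩
      suc M * (∣Aut H ∣ * n ^ edgeCount H * copies H G)
        ∎
      where
      shuffle : ∀ e c a → e * (c * a) ≡ a * e * c
      shuffle = solve-∀

      ∣allFin∣ : length (allFin N) ≡ N
      ∣allFin∣ = length-tabulate (λ i → i)

      open ManyEmbeddings (embed n G noIndep (Unique.allFin⁺ N) (begin
        C * n ^ differing (lookup c v) c   ≤⟨ *-monoʳ-≤ C (^-monoʳ-≤ n (differing≤degree H c adj v)) ⟩
        C * n ^ degree H v                 ≡⟨ cong (λ z → C * n ^ z) δ≡ ⟨
        C * n ^ δ H                        ≤⟨ large ⟩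
        N                                  ≡⟨ ∣allFin∣ ⟨
        length (allFin N)                  ∎))

-- Passage to rational numbers

open Counting using (many-copies)
open import Data.Integer.Base as ℤ using (+_; -[1+_])
import Data.Integer.Properties as ℤₚ
open import Data.Rational.Base as ℚ using (ℚ; mkℚ; 0ℚ; 1ℚ; *<*; toℚᵘ; _<_; _≤_; _/_)
import Data.Rational.Properties as ℚₚ
open import Data.Rational.Unnormalised.Base as ℚᵘ using (mkℚᵘ; 1ℚᵘ)
import Data.Rational.Unnormalised.Properties as ℚᵘₚ

-- M + 1 is the denominator of ε, so that 1 − ε ≤ M / (M + 1).
[1-ε]*x/y≤c : ∀ ε → 0ℚ < ε → ∃[ M ] (∀ x y c .{{_ : NonZero y}} → M * x ℕ.≤ suc M * (y * c) →
  (1ℚ ℚ.- ε) ℚ.* (+ x / y) ≤ + c / 1)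
[1-ε]*x/y≤c (mkℚ (+ zero)   _ _) (*<* (ℤ.+<+ ()))
[1-ε]*x/y≤c (mkℚ -[1+ _ ]   _ _) (*<* ())
[1-ε]*x/y≤c ε@(mkℚ (+ suc a) M _) _ = M , bound
  where
  -- For ε = (a + 1)/(M + 1) the numerator of 1 - ε is M - a, which is negative when ε > 1; the
  -- bound covers that case too.
  numerator≤M : (+ 1 ℤ.* + suc M) ℤ.+ (-[1+ a ] ℤ.* + 1) ℤ.≤ + M
  numerator≤M rewrite ℕₚ.+-identityʳ M | ℕₚ.*-identityʳ a =
    ℤₚ.≤-trans (ℤₚ.≤-reflexive (ℤₚ.[1+m]⊖[1+n]≡m⊖n M a)) (ℤₚ.m⊖n≤m M a)

  bound : ∀ x y c .{{_ : NonZero y}} → M * x ℕ.≤ suc M * (y * c) →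
    (1ℚ ℚ.- ε) ℚ.* (+ x / y) ≤ + c / 1
  bound x y@(suc y-1) c h = ℚₚ.toℚᵘ-cancel-≤ (begin
    toℚᵘ ((1ℚ ℚ.- ε) ℚ.* (+ x / y))
      ≃⟨ ℚₚ.toℚᵘ-homo-* (1ℚ ℚ.- ε) (+ x / y) ⟩
    toℚᵘ (1ℚ ℚ.- ε) ℚᵘ.* toℚᵘ (+ x / y)
      ≃⟨ ℚᵘₚ.*-cong (ℚᵘₚ.≃-trans (ℚₚ.toℚᵘ-homo-+ 1ℚ (ℚ.- ε)) (ℚᵘₚ.+-congʳ 1ℚᵘ (ℚₚ.toℚᵘ-homo‿- ε)))
                    (ℚₚ.toℚᵘ-fromℚᵘ (mkℚᵘ (+ x) y-1)) ⟩
    (1ℚᵘ ℚᵘ.- toℚᵘ ε) ℚᵘ.* mkℚᵘ (+ x) y-1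
      ≤⟨ ℚᵘ.*≤* cross ⟩
    mkℚᵘ (+ c) 0
      ≃⟨ ℚₚ.toℚᵘ-fromℚᵘ (mkℚᵘ (+ c) 0) ⟨
    toℚᵘ (+ c / 1)
      ∎)
    where
    open ℚᵘₚ.≤-Reasoning

    shuffle : ∀ m y c → suc m * (y * c) ≡ c * ((suc m + 0) * y)
    shuffle = solve-∀

    cross : ((+ 1 ℤ.* + suc M) ℤ.+ (-[1+ a ] ℤ.* + 1)) ℤ.* + x ℤ.* + 1 ℤ.≤ + c ℤ.* + ((suc M + 0) * y)
    cross = ℤₚ.≤-trans (ℤₚ.≤-reflexive (ℤₚ.*-identityʳ _)) (ℤₚ.≤-trans
      (ℤₚ.*-monoʳ-≤-nonNeg (+ x) numerator≤M) (ℤₚ.≤-trans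
      (ℤₚ.≤-reflexive (sym (ℤₚ.pos-* M x))) (ℤₚ.≤-trans
      (ℤ.+≤+ (ℕₚ.≤-trans h (ℕₚ.≤-reflexive (shuffle M y c))))
      (ℤₚ.≤-reflexive (ℤₚ.pos-* c _)))))

theorem3p3 : ∀ {k} (H : Graph (suc k)) → CompleteMultipartite H →
    (ε : ℚ) → 0ℚ < ε →
    ∃[ C ] (∀ (n N : ℕ) .{{_ : NonZero n}} .{{_ : NonZero N}} →
    N ≥ C * n ^ δ H →
    (∀ (G : Graph N) → NoIndependentSetOfSize n G →
    lowerBound H ε N n ≤ + copies H G / 1) ×
    (∀ m → f[ N , H , n ]≡ m → lowerBound H ε N n ≤ + m / 1))
theorem3p3 {k} H H-multipartite ε ε>0 = proj₁ copies-bound , λ n N N≥ →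
  (λ G noIndep → lower n N G noIndep N≥) ,
  -- The minimum `m` is attained by `G`, so the bound for single graphs passes to it.
  (λ m ((G , noIndep , copies≡m) , _) →
    subst (λ z → lowerBound H ε N n ≤ + z / 1) copies≡m (lower n N G noIndep N≥))
  where
  to-ℚ = [1-ε]*x/y≤c ε ε>0
  copies-bound = many-copies H H-multipartite (proj₁ to-ℚ)

  lower : ∀ n N .{{_ : NonZero n}} (G : Graph N) → NoIndependentSetOfSize n G → N ≥ proj₁ copies-bound * n ^ δ H →
    lowerBound H ε N n ≤ + copies H G / 1
  lower n N G noIndep N≥ = proj₂ to-ℚ (N ^ suc k) (∣Aut H ∣ * n ^ edgeCount H) (copies H G)
    {{ℕₚ.m*n≢0 ∣Aut H ∣ (n ^ edgeCount H) {{∣Aut∣≢0 H}} {{ℕₚ.m^n≢0 n (edgeCount H)}}}}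
    (proj₂ copies-bound n G noIndep N≥)
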